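{- Let $Q$ be the cube graph. The pot $$P_2=\big\{\{1,1,1\},\{2,2,2\},\{ -2,-3,-3\},\{ -1,-4,-4\},\{3,4,5\},\{ -1,-2,-5\}\big\}$$ (inner braces denoting multisets) is a biminimal pot that $3$-realizes the cube; that is, $P_2$ $3$-realizes $Q$, $|P_2|=T_3(Q)$ and $|\Sigma(P_2)|=B_3(Q)$.
   Context: Graphs are connected, have non-empty vertex set, and may have loops and multiple edges. Formally a graph is a triple $(V(G),E(G),\mu)$ with $\mu$ assigning to each edge an unordered pair of (not necessarily distinct) vertices (undirected graph) or an ordered pair of vertices (directed graph). An orientation $\vec G$ of an undirected graph $G$ is a directed graph obtained by choosing a direction for every edge of $G$. The cube $Q$ is the simple undirected graph with vertex set $\mathbb{Z}_2^3$ in which $x,y$ are adjacent iff $x-y\in\{100,010,001\}$. An edge-coloring of a graph with $c$ colors is any map $\lambda$ from its edge set to $[1,c]=\{1,\dots,c\}$ (no properness required). A tile is a finite multiset of integers; a pot is a set of tiles. $\Sigma(P)$ is the set of positive integers (colors) appearing in some tile of the pot $P$. For an edge-coloring $\lambda$ of a directed graph $D$ and a vertex $x$, the tile $\tau_x(\lambda)$ is the multiset containing one copy of $\lambda(e)$ for each non-loop edge $e$ with tail $x$ (i.e. $e=(x,y)$, $y\ne x$), one copy of $-\lambda(e)$ for each non-loop edge $e$ with head $x$ (i.e. $e=(y,x)$, $y\neq x$), and both $\lambda(e)$ and $-\lambda(e)$ for each loop $e$ at $x$. The pot induced by $\lambda$ is $\mathcal{P}(\lambda)=\{\tau_x(\lambda)\mid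 x\in V(D)\}$ (a set of distinct tiles). A pot $P$ realizes an undirected graph $G$, written $G\in\mathcal{O}(P)$, if there is an edge-coloring $\lambda$ of some orientation of $G$ with $\mathcal{P}(\lambda)\subseteq P$. $P$ $3$-realizes $G$ if $G\in\mathcal{O}(P)$ and there is no $H\in\mathcal{O}(P)$ with $H\not\simeq G$ and $|V(H)|\le|V(G)|$. $T_3(G)=\min\{|P| : P \text{ is a pot that 3-realizes } G\}$ and $B_3(G)=\min\{|\Sigma(P)| : P \text{ is a pot that 3-realizes } G\}$ (two independent minima). A pot $P$ that $3$-realizes $G$ is biminimal if $|P|=T_3(G)$ and $|\Sigma(P)|=B_3(G)$. -}

module Defs where

open import Data.Fin.Base using (Fin; zero; suc; toℕ; finToFun; _<_)
open import Data.Fin.Patterns using (0F; 1F; 2F; 3F; 4F; 5F; 6F; 7F)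
open import Data.Fin.Properties using (any?; _<?_) renaming (_≟_ to _≟ᶠ_)
open import Data.Integer.Base using (ℤ; +_; -_; 0ℤ; ∣_∣)
import Data.Integer.Base as ℤ
import Data.Integer.Properties as ℤₚ
open import Data.List.Base
  using (List; []; _∷_; _++_; length; lookup; map; concat; concatMap; filter;
         deduplicate; allFin; cartesianProduct)
open import Data.List.Relation.Binary.Permutation.Propositional using (_↭_; ↭-setoid)
open import Data.List.Relation.Binary.Permutation.Propositional.Properties using (map⁺)
import Data.List.Relation.Unary.AllPairs as AllPairs
import Data.List.Membership.DecPropositional as DecMembership
import Data.List.Membership.Setoid as SetoidMembership
import Data.List.Relation.Unary.Unique.Setoid as SetoidUnique
open import Data.Nat.Base using (ℕ; NonZero; _+_; _∸_; _*_; _^_; _≤_)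
open import Data.Nat.DivMod using (_mod_)
open import Data.Nat.ListAction using (sum)
open import Data.Nat.ListAction.Properties using (sum-↭)
import Data.Nat.Properties as ℕₚ
open import Data.Product.Base using (Σ; ∃; ∃-syntax; _×_; _,_; proj₁; proj₂; swap)
import Data.Product.Base as Product
open import Data.Product.Properties using (≡-dec)
open import Data.Sum.Base using (_⊎_; inj₁; inj₂)
open import Data.Vec.Base using (Vec; []; _∷_; tabulate)
import Data.Vec.Properties as Vecₚ
open import Function.Base using (_∘_)
open import Function.Bundles using (_⤖_; module Bijection)
open import Level using (0ℓ)
open import Relation.Binary.Construct.Closure.ReflexiveTransitive
  using (Star; ε; _◅_; _◅◅_; reverse)
open import Relation.Binary.PropositionalEquality.Core using (_≡_; _≢_; refl; cong)
open import Relation.Nullary.Decidable using (Dec; toWitness; True; _×-dec_; _⊎-dec_; ¬?)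
open import Relation.Nullary.Negation.Core using (¬_)
open import Relation.Unary using (Pred; _⊆_; Decidable)

-- Equality of ordered pairs regarded as unordered pairs.
infix 4 _≈ᵤ_
_≈ᵤ_ : {A : Set} → A × A → A × A → Set
p ≈ᵤ q = p ≡ q ⊎ swap p ≡ q

module _ {n m : ℕ} (μ : Fin m → Fin n × Fin n) where

  Adjacent : Fin n → Fin n → Set
  Adjacent x y = ∃[ e ] μ e ≈ᵤ (x , y)

  Connected : Set
  Connected = ∀ x y → Star Adjacent x y

-- Finite undirected graphs, up to numbering of the vertices and edges; loops
-- and parallel edges are allowed.  The order in which `ends` lists the two
-- ends of an edge carries no meaning.
record Graph : Set where
  field
    order     : ℕ
    size      : ℕ
    ends      : Fin size → Fin order × Fin order
    nonEmpty  : NonZero order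
    connected : Connected ends

infix 4 _≃_
record _≃_ (G H : Graph) : Set where
  private
    module G = Graph G
    module H = Graph H
  field
    vertices : Fin G.order ⤖ Fin H.order
    edges    : Fin G.size ⤖ Fin H.size
    ends     : ∀ e → Product.map (Bijection.to vertices) (Bijection.to vertices) (G.ends e)
                     ≈ᵤ H.ends (Bijection.to edges e)

record Digraph : Set where
  field
    order : ℕ
    size  : ℕ
    arc   : Fin size → Fin order × Fin order

  tail head : Fin size → Fin order
  tail = proj₁ ∘ arc
  head = proj₂ ∘ arc

record Orientation (G : Graph) : Set where
  open Graph G
  field
    arc     : Fin size → Fin order × Fin order
    orients : ∀ e → arc e ≈ᵤ ends e

  digraph : Digraph
  digraph = record { order = order ; size = size ; arc = arc }

-- Lists of integers represent finite multisets; tiles are compared up to _↭_.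
Tile : Set
Tile = List ℤ

open SetoidUnique (↭-setoid {A = ℤ}) public using (Unique)
open SetoidMembership (↭-setoid {A = ℤ}) public using () renaming (_∈_ to _∈ₜ_)

record Pot : Set where
  constructor pot
  field
    tiles    : List Tile
    distinct : Unique tiles

open Pot public

infix 4 _∈ₚ_
_∈ₚ_ : Tile → Pot → Set
t ∈ₚ P = t ∈ₜ tiles P

∣_∣ₚ : Pot → ℕ
∣ P ∣ₚ = length (tiles P)

colours : Pot → List ℤ
colours P = deduplicate ℤₚ._≟_ (filter (0ℤ ℤₚ.<?_) (concat (tiles P)))

∣Σ_∣ : Pot → ℕ
∣Σ P ∣ = length (colours P)

EdgeColouring : Digraph → ℕ → Set
EdgeColouring D c = Fin (Digraph.size D) → Fin c

-- Fin c = {0, …, c-1} stands for the set of colours {1, …, c}.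
colour : ∀ {c} → Fin c → ℤ
colour i = + ℕ.suc (toℕ i)

module _ (D : Digraph) {c : ℕ} (col : EdgeColouring D c) where
  open Digraph D

  -- A loop at x has x both as tail and as head, so it contributes its colour
  -- and the negative of its colour.
  tile : Fin order → Tile
  tile x = map (λ e →    colour (col e))  (filter (λ e → tail e ≟ᶠ x) (allFin size))
        ++ map (λ e → - (colour (col e))) (filter (λ e → head e ≟ᶠ x) (allFin size))

  inducedPot : Pred Tile 0ℓ
  inducedPot t = ∃[ x ] t ↭ tile x

infix 4 _Realizes_ _3-Realizes_

_Realizes_ : Pot → Graph → Set
P Realizes G =
  Σ (Orientation G) λ O → let D = Orientation.digraph O in
    ∃[ c ] Σ (EdgeColouring D c) λ col → inducedPot D col ⊆ (_∈ₚ P)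

_3-Realizes_ : Pot → Graph → Set
P 3-Realizes G =
  P Realizes G ×
  ¬ (∃[ H ] P Realizes H × ¬ (H ≃ G) × Graph.order H ≤ Graph.order G)

IsMinimum : Pred ℕ 0ℓ → ℕ → Set
IsMinimum S k = S k × (∀ {m} → S m → k ≤ m)

-- IsT₃ G k and IsB₃ G k say that T₃(G) = k and B₃(G) = k.
IsT₃ IsB₃ : Graph → ℕ → Set
IsT₃ G = IsMinimum λ k → ∃[ P ] P 3-Realizes G × ∣ P ∣ₚ ≡ k
IsB₃ G = IsMinimum λ k → ∃[ P ] P 3-Realizes G × ∣Σ P ∣ ≡ k

Biminimal : Pot → Graph → Set
Biminimal P G = P 3-Realizes G × IsT₃ G ∣ P ∣ₚ × IsB₃ G ∣Σ P ∣

-- Subtraction modulo 2.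
_-₂_ : Fin 2 → Fin 2 → Fin 2
a -₂ b = (toℕ a + (2 ∸ toℕ b)) mod 2

-- `finToFun` identifies Fin (2 ^ 3) with the functions Fin 3 → Fin 2.
difference : Fin (2 ^ 3) → Fin (2 ^ 3) → Vec (Fin 2) 3
difference x y = tabulate λ i → finToFun {2} {3} x i -₂ finToFun {2} {3} y i

units : List (Vec (Fin 2) 3)
units = (1F ∷ 0F ∷ 0F ∷ []) ∷ (0F ∷ 1F ∷ 0F ∷ []) ∷ (0F ∷ 0F ∷ 1F ∷ []) ∷ []

open DecMembership (Vecₚ.≡-dec {n = 3} (_≟ᶠ_ {2})) using (_∈_; _∈?_)

-- x < y selects one of the two orderings of each adjacent pair.
IsCubeEdge : Pred (Fin (2 ^ 3) × Fin (2 ^ 3)) 0ℓ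
IsCubeEdge (x , y) = x < y × difference x y ∈ units

isCubeEdge? : Decidable IsCubeEdge
isCubeEdge? (x , y) = (x <? y) ×-dec (difference x y ∈? units)

cubeEdges : List (Fin (2 ^ 3) × Fin (2 ^ 3))
cubeEdges = filter isCubeEdge? (cartesianProduct (allFin (2 ^ 3)) (allFin (2 ^ 3)))

private
  Adj : Fin (2 ^ 3) → Fin (2 ^ 3) → Set
  Adj = Adjacent (lookup cubeEdges)

  adj? : ∀ x y → Dec (Adj x y)
  adj? x y = any? λ e → ≡-dec _≟ᶠ_ _≟ᶠ_ (lookup cubeEdges e) (x , y)
                  ⊎-dec ≡-dec _≟ᶠ_ _≟ᶠ_ (swap (lookup cubeEdges e)) (x , y)

  step : ∀ x y {_ : True (adj? x y)} → Adj x y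
  step x y {t} = toWitness t

  toOrigin : ∀ x → Star Adj x 0F
  toOrigin 0F = ε
  toOrigin 1F = step 1F 0F ◅ ε
  toOrigin 2F = step 2F 0F ◅ ε
  toOrigin 3F = step 3F 1F ◅ step 1F 0F ◅ ε
  toOrigin 4F = step 4F 0F ◅ ε
  toOrigin 5F = step 5F 1F ◅ step 1F 0F ◅ ε
  toOrigin 6F = step 6F 2F ◅ step 2F 0F ◅ ε
  toOrigin 7F = step 7F 3F ◅ step 3F 1F ◅ step 1F 0F ◅ ε

  adj-sym : ∀ {x y} → Adj x y → Adj y x
  adj-sym (e , inj₁ eq) = e , inj₂ (cong swap eq)
  adj-sym (e , inj₂ eq) = e , inj₁ (cong swap eq)

Q : Graph
Q = record
  { order     = 2 ^ 3
  ; size      = length cubeEdges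
  ; ends      = lookup cubeEdges
  ; nonEmpty  = _
  ; connected = λ x y → toOrigin x ◅◅ reverse adj-sym (toOrigin y)
  }

P₂-tiles : List Tile
P₂-tiles =
  (+ 1 ∷ + 1 ∷ + 1 ∷ []) ∷
  (+ 2 ∷ + 2 ∷ + 2 ∷ []) ∷
  (- + 2 ∷ - + 3 ∷ - + 3 ∷ []) ∷
  (- + 1 ∷ - + 4 ∷ - + 4 ∷ []) ∷
  (+ 3 ∷ + 4 ∷ + 5 ∷ []) ∷
  (- + 1 ∷ - + 2 ∷ - + 5 ∷ []) ∷ []

private
  -- The sum of squares separates the six tiles.
  norm : Tile → ℕ
  norm t = sum (map (λ z → ∣ z ∣ * ∣ z ∣) t)

  norm-resp-↭ : ∀ {s t} → s ↭ t → norm s ≡ norm t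
  norm-resp-↭ p = sum-↭ (map⁺ _ p)

P₂ : Pot
P₂ = pot P₂-tiles
  (AllPairs.map (_∘ norm-resp-↭)
    (toWitness {a? = AllPairs.allPairs? (λ s t → ¬? (norm s ℕₚ.≟ norm t)) P₂-tiles} _))

{-# OPTIONS --safe #-}

-- Lower bounds.  In a coloured orientation of Q whose pot 3-realizes Q, exchange
-- the heads of two arcs of the same colour.  No tile changes, and the new graph
-- is connected because Q stays connected without any two of its edges, so it
-- must be a cube again: bipartite and without parallel edges.  Hence each colour
-- is directed throughout from even to odd vertices or throughout from odd to
-- even ones, and two edges of the same colour share an end or are antipodal.
--
-- Two vertices with equal tiles then have equal parity, no three vertices have
-- equal tiles, and if the tiles coincide in two pairs on one side of the
-- bipartition, then they are distinct on the other side.  So there are at least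
-- 3 + 3 or 2 + 4 tiles.
--
-- With at most four colours, every colour class would be the star of a vertex
-- of one fixed side.  The stars of the three neighbours of a vertex w, together
-- with three copies of w, then realize K₃,₃, which has only six vertices.
--
-- Uniqueness.  In a graph realized by P₂, arcs can be followed from any vertex
-- to one with tile {3,4,5}, from there to the vertex {-2,-3,-3} and back to two
-- vertices {3,4,5}, and from these to all eight vertices of a cube.  With at
-- most eight vertices there are no others, and since every edge has an end at
-- which its label occurs only once in the tile, the edges are determined too.
module Submission where

open import Defs
open import Data.Bool.Base using (Bool; true; false; not; _xor_)
open import Data.Bool.Properties using (¬-not; not-¬; not-injective; not-involutive; xor-annihilates-not)
  renaming (_≟_ to _≟ᵇ_)
open import Data.Empty using (⊥)
open import Data.Fin using (#_)
open import Data.Fin.Base using (Fin; opposite; inject≤; remQuot; combine; _↑ˡ_; _↑ʳ_; splitAt)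
open import Data.Fin.Patterns
open import Data.Fin.Permutation using (↔⇒≡)
open import Data.Fin.Properties
  using (all?; any?; toℕ-injective; injective⇒≤; inject≤-injective; remQuot-combine; combine-remQuot;
         ↑ˡ-injective; ↑ʳ-injective; splitAt-↑ˡ; splitAt-↑ʳ; splitAt⁻¹-↑ˡ; splitAt⁻¹-↑ʳ)
  renaming (_≟_ to _≟ᶠ_)
open import Data.Integer.Base using (ℤ; +_; -_; 0ℤ)
import Data.Integer.Base as ℤ
import Data.Integer.Properties as ℤₚ
open import Data.List.Base as List
  using (List; []; _∷_; _++_; map; filter; allFin; length; concat; _ʳ++_)
open import Data.List.Membership.Propositional using (_∈_)
open import Data.List.Membership.Propositional.Properties
  using (∈-map⁺; ∈-map⁻; ∈-filter⁺; ∈-filter⁻; ∈-++⁺ˡ; ∈-++⁺ʳ; ∈-++⁻; ∈-allFin; ∈-deduplicate⁺; ∈-lookup)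
open import Data.List.Membership.Propositional.Properties.WithK using (unique∧set⇒bag)
import Data.List.Membership.Setoid.Properties as Membershipₛ
open import Data.List.Properties using (map-++; map-∘; map-cong; length-map; ∷-injectiveˡ; ∷-injectiveʳ)
open import Data.List.Relation.Binary.BagAndSetEquality using (∼bag⇒↭)
open import Data.List.Relation.Binary.Permutation.Propositional as Perm
  using (_↭_; prep; ↭-refl; ↭-sym; ↭-trans; ↭-reflexive; ↭-setoid; ↭⇒↭ₛ; module PermutationReasoning)
open import Data.List.Relation.Binary.Permutation.Propositional.Properties using (map⁺; ∈-resp-↭; ↭-map-inv)
import Data.List.Relation.Binary.Permutation.Setoid.Properties as Permutationₛ
open import Data.List.Relation.Unary.All as All using (All; []; _∷_)
import Data.List.Relation.Unary.All.Properties as Allₚ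
open import Data.List.Relation.Unary.AllPairs using (AllPairs; []; _∷_)
import Data.List.Relation.Unary.AllPairs.Properties as AllPairsₚ
open import Data.List.Relation.Unary.Any as Any using (Any; here; there; index)
import Data.List.Relation.Unary.Any.Properties as Anyₚ
import Data.List.Relation.Unary.Unique.Propositional as Propositional
import Data.List.Relation.Unary.Unique.Propositional.Properties as Uniqueₚ
open import Data.Nat.Base using (ℕ; suc; NonZero; _≤_; s≤s; z<s)
import Data.Nat.Properties as ℕₚ
open import Data.Product.Base as Product using (∃-syntax; _×_; _,_; _,′_; proj₁; proj₂; swap)
open import Data.Product.Properties using (,-injectiveˡ; ≡-dec)
open import Data.Sum.Base using (_⊎_; inj₁; inj₂; [_,_]′)
open import Data.Vec.Base using (Vec; []; _∷_; lookup)
open import Function.Base using (_∘_; id; const; case_of_)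
open import Function.Bundles using (mk⤖; mk⇔; module Bijection; module Inverse)
open import Function.Consequences.Propositional using (strictlySurjective⇒surjective)
open import Function.Properties.Bijection using (sym-≡; ⤖⇒↔)
open import Relation.Binary.Construct.Closure.ReflexiveTransitive as Star using (Star; ε; _◅_; _◅◅_; _⋆)
open import Relation.Binary.PropositionalEquality
  using (_≡_; _≢_; refl; sym; trans; cong; cong₂; subst; subst₂; setoid)
open import Relation.Nullary.Decidable using (Dec; yes; no; _×-dec_; _⊎-dec_; _→-dec_; ¬?; from-yes)
open import Relation.Nullary.Negation using (¬_; contradiction)

-- Unordered pairs and isomorphisms

module _ {A : Set} where

  ≈ᵤ-sym : {p q : A × A} → p ≈ᵤ q → q ≈ᵤ p
  ≈ᵤ-sym (inj₁ refl) = inj₁ refl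
  ≈ᵤ-sym (inj₂ refl) = inj₂ refl

  ≈ᵤ-trans : {p q r : A × A} → p ≈ᵤ q → q ≈ᵤ r → p ≈ᵤ r
  ≈ᵤ-trans (inj₁ refl) q≈r         = q≈r
  ≈ᵤ-trans (inj₂ refl) (inj₁ refl) = inj₂ refl
  ≈ᵤ-trans (inj₂ refl) (inj₂ refl) = inj₁ refl

≈ᵤ-map : {A B : Set} (f : A → B) {p q : A × A} → p ≈ᵤ q → Product.map f f p ≈ᵤ Product.map f f q
≈ᵤ-map f (inj₁ refl) = inj₁ refl
≈ᵤ-map f (inj₂ refl) = inj₂ refl

≃-sym : ∀ {G H} → G ≃ H → H ≃ G
≃-sym {G} {H} G≃H = record
  { vertices = sym-≡ vertices
  ; edges    = sym-≡ edges
  ; ends     = λ e → ≈ᵤ-sym (≈ᵤ-trans (inj₁ (sym (cong₂ _,_ (V.strictlyInverseʳ _) (V.strictlyInverseʳ _))))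
                 (≈ᵤ-map V.from (≈ᵤ-trans (ends (E.from e)) (inj₁ (cong (Graph.ends H) (E.strictlyInverseˡ e))))))
  }
  where
  open _≃_ G≃H
  module V = Inverse (⤖⇒↔ vertices)
  module E = Inverse (⤖⇒↔ edges)

unique∧set⇒↭ : ∀ {A : Set} {xs ys : List A} → Propositional.Unique xs → Propositional.Unique ys →
               (∀ {x} → x ∈ xs → x ∈ ys) → (∀ {x} → x ∈ ys → x ∈ xs) → xs ↭ ys
unique∧set⇒↭ xs! ys! xs⊆ys ys⊆xs = ∼bag⇒↭ (unique∧set⇒bag xs! ys! (mk⇔ xs⊆ys ys⊆xs))

-- Half-edges and tiles

colour-positive : ∀ {c} (i : Fin c) → 0ℤ ℤ.< colour i
colour-positive i = ℤ.+<+ z<s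

colour-injective : ∀ {c} {i j : Fin c} → colour i ≡ colour j → i ≡ j
colour-injective = toℕ-injective ∘ ℕₚ.suc-injective ∘ ℤₚ.+-injective

module HalfEdges (D : Digraph) {c : ℕ} (col : EdgeColouring D c) where
  open Digraph D

  -- The mark `true` stands for the half at the tail. A loop has two different halves at one vertex,
  -- matching its two entries in the tile, so every tile is the image under `label` of a list of
  -- halves without repetition.
  Half : Set
  Half = Fin size × Bool

  at : Half → Fin order
  at (e , true)  = tail e
  at (e , false) = head e

  label : Half → ℤ
  label (e , true)  = colour (col e)
  label (e , false) = - colour (col e)

  mate : Half → Half
  mate (e , b) = e , not b

  label-mate : ∀ h → label (mate h) ≡ - label h
  label-mate (e , true)  = refl
  label-mate (e , false) = refl

  -- Colours are positive, so the sign of a label tells the half at the tail from the half at the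
  -- head.
  label≡⇒ : ∀ h h′ → label h ≡ label h′ → col (proj₁ h) ≡ col (proj₁ h′) × proj₂ h ≡ proj₂ h′
  label≡⇒ (e , true)  (f , true)  eq = colour-injective eq , refl
  label≡⇒ (e , false) (f , false) eq = colour-injective (ℤₚ.neg-injective eq) , refl

  outgoing incoming : Fin order → List (Fin size)
  outgoing x = filter (λ e → tail e ≟ᶠ x) (allFin size)
  incoming x = filter (λ e → head e ≟ᶠ x) (allFin size)

  star : Fin order → List Half
  star x = map (_, true) (outgoing x) ++ map (_, false) (incoming x)

  map-label-star : ∀ x → map label (star x) ≡ tile D col x
  map-label-star x = trans (map-++ label (map (_, true) (outgoing x)) _)
                           (cong₂ _++_ (sym (map-∘ (outgoing x))) (sym (map-∘ (incoming x))))

  ∈-star⁺ : ∀ h → h ∈ star (at h)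
  ∈-star⁺ (e , true)  = ∈-++⁺ˡ (∈-map⁺ _ (∈-filter⁺ (λ e → tail e ≟ᶠ _) (∈-allFin e) refl))
  ∈-star⁺ (e , false) = ∈-++⁺ʳ _ (∈-map⁺ _ (∈-filter⁺ (λ e → head e ≟ᶠ _) (∈-allFin e) refl))

  ∈-star⁻ : ∀ {x h} → h ∈ star x → at h ≡ x
  ∈-star⁻ {x} h∈ with ∈-++⁻ (map (_, true) (outgoing x)) h∈
  ... | inj₁ p with e , e∈ , refl ← ∈-map⁻ (_, true) p  =
    proj₂ (∈-filter⁻ (λ e → tail e ≟ᶠ x) {xs = allFin size} e∈)
  ... | inj₂ p with e , e∈ , refl ← ∈-map⁻ (_, false) p =
    proj₂ (∈-filter⁻ (λ e → head e ≟ᶠ x) {xs = allFin size} e∈)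

  star-unique : ∀ x → Propositional.Unique (star x)
  star-unique x = Uniqueₚ.++⁺
    (Uniqueₚ.map⁺ ,-injectiveˡ (Uniqueₚ.filter⁺ (λ e → tail e ≟ᶠ x) (Uniqueₚ.allFin⁺ size)))
    (Uniqueₚ.map⁺ ,-injectiveˡ (Uniqueₚ.filter⁺ (λ e → head e ≟ᶠ x) (Uniqueₚ.allFin⁺ size)))
    λ (p , q) → case trans (sym (proj₂ (proj₂ (∈-map⁻ (_, true) p)))) (proj₂ (proj₂ (∈-map⁻ (_, false) q))) of λ ()

  ∈-tile : ∀ h → label h ∈ tile D col (at h)
  ∈-tile h = subst (label h ∈_) (map-label-star (at h)) (∈-map⁺ label (∈-star⁺ h))

  ∈-tile⁻ : ∀ {x z} → z ∈ tile D col x → ∃[ h ] at h ≡ x × label h ≡ z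
  ∈-tile⁻ {x} z∈ with h , h∈ , refl ← ∈-map⁻ label (subst (_ ∈_) (sym (map-label-star x)) z∈) = h , ∈-star⁻ h∈ , refl

  colour∈colours : ∀ {P : Pot} → (∀ x → tile D col x ∈ₚ P) → ∀ e → colour (col e) ∈ colours P
  colour∈colours {P} sub e = ∈-deduplicate⁺ ℤₚ._≟_ (∈-filter⁺ (0ℤ ℤₚ.<?_) (∈-concat (sub (tail e))) (colour-positive (col e)))
    where
    ∈-concat : ∀ {ts : List Tile} → tile D col (tail e) ∈ₜ ts → colour (col e) ∈ concat ts
    ∈-concat (here p)  = ∈-++⁺ˡ (∈-resp-↭ p (∈-tile (e , true)))
    ∈-concat (there p) = ∈-++⁺ʳ _ (∈-concat p)

-- Unlike Uniqueₚ.map⁺, this asks for injectivity on the members of the list only.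
map-unique : ∀ {A B : Set} {f : A → B} {xs} → Propositional.Unique xs →
             (∀ {x y} → x ∈ xs → y ∈ xs → f x ≡ f y → x ≡ y) → Propositional.Unique (map f xs)
map-unique []         _   = []
map-unique (x∉ ∷ xs!) inj =
  Allₚ.map⁺ (All.tabulate λ y∈ eq → All.lookup x∉ y∈ (inj (here refl) (there y∈) eq))
  ∷ map-unique xs! (λ p q → inj (there p) (there q))

module _ {D′ D : Digraph} {c′ c : ℕ} {col′ : EdgeColouring D′ c′} {col : EdgeColouring D c} where
  private
    module D′ = HalfEdges D′ col′
    module D = HalfEdges D col

  -- The hypotheses make `φ` a bijection from the halves at `x` to those at `π x`. The halves of one
  -- edge may be sent to different edges, which permits cutting and regluing, and `π` may identify
  -- vertices, which permits several copies of a vertex.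
  local-isomorphism : (π : Fin (Digraph.order D′) → Fin (Digraph.order D)) (φ : D′.Half → D.Half) →
    (∀ h → D.label (φ h) ≡ D′.label h) →
    (∀ h → D.at (φ h) ≡ π (D′.at h)) →
    (∀ h h′ → D′.at h ≡ D′.at h′ → φ h ≡ φ h′ → h ≡ h′) →
    (∀ x g → D.at g ≡ π x → ∃[ h ] D′.at h ≡ x × φ h ≡ g) →
    ∀ x → tile D′ col′ x ↭ tile D col (π x)
  local-isomorphism π φ label-φ at-φ inj surj x = begin
    tile D′ col′ x                        ≡⟨ D′.map-label-star x ⟨
    map D′.label (D′.star x)              ≡⟨ map-cong (sym ∘ label-φ) (D′.star x) ⟩
    map (D.label ∘ φ) (D′.star x)         ≡⟨ map-∘ (D′.star x) ⟩
    map D.label (map φ (D′.star x))       ↭⟨ map⁺ D.label φ-star ⟩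
    map D.label (D.star (π x))            ≡⟨ D.map-label-star (π x) ⟩
    tile D col (π x)                      ∎
    where
    open PermutationReasoning
    to : ∀ {g} → g ∈ map φ (D′.star x) → g ∈ D.star (π x)
    to p with h , h∈ , refl ← ∈-map⁻ φ p =
      subst (λ y → φ h ∈ D.star y) (trans (at-φ h) (cong π (D′.∈-star⁻ h∈))) (D.∈-star⁺ (φ h))
    from : ∀ {g} → g ∈ D.star (π x) → g ∈ map φ (D′.star x)
    from {g} p with h , refl , refl ← surj x g (D.∈-star⁻ p) = ∈-map⁺ φ (D′.∈-star⁺ h)
    φ-star : map φ (D′.star x) ↭ D.star (π x)
    φ-star = unique∧set⇒↭
      (map-unique (D′.star-unique x) λ p q → inj _ _ (trans (D′.∈-star⁻ p) (sym (D′.∈-star⁻ q))))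
      (D.star-unique (π x)) to from

∈ₚ-resp-↭ : ∀ (P : Pot) {s t} → s ↭ t → s ∈ₚ P → t ∈ₚ P
∈ₚ-resp-↭ P = Membershipₛ.∈-resp-≈ ↭-setoid

realizes : ∀ (P : Pot) {G} (O : Orientation G) {c} (col : EdgeColouring (Orientation.digraph O) c) →
           (∀ x → tile (Orientation.digraph O) col x ∈ₚ P) → P Realizes G
realizes P O col sub = O , _ , col , λ (x , t↭) → ∈ₚ-resp-↭ P (↭-sym t↭) (sub x)

-- Exchanging the heads of two arcs

module Exchange {m : ℕ} (e f : Fin m) where

  exchange : Fin m → Fin m
  exchange g with g ≟ᶠ e | g ≟ᶠ f
  ... | yes _ | _     = f
  ... | no  _ | yes _ = e
  ... | no  _ | no  _ = g

  exchange-e : exchange e ≡ f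
  exchange-e with e ≟ᶠ e | e ≟ᶠ f
  ... | yes _   | _ = refl
  ... | no  e≢e | _ = contradiction refl e≢e

  exchange-f : exchange f ≡ e
  exchange-f with f ≟ᶠ e | f ≟ᶠ f
  ... | yes f≡e | _       = f≡e
  ... | no  _   | yes _   = refl
  ... | no  _   | no  f≢f = contradiction refl f≢f

  exchange-other : ∀ {g} → g ≢ e → g ≢ f → exchange g ≡ g
  exchange-other {g} g≢e g≢f with g ≟ᶠ e | g ≟ᶠ f
  ... | yes g≡e | _       = contradiction g≡e g≢e
  ... | no  _   | yes g≡f = contradiction g≡f g≢f
  ... | no  _   | no  _   = refl

  exchange-involutive : ∀ g → exchange (exchange g) ≡ g
  exchange-involutive g with g ≟ᶠ e | g ≟ᶠ f
  ... | yes g≡e | _       = trans exchange-f (sym g≡e)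
  ... | no  _   | yes g≡f = trans exchange-e (sym g≡f)
  ... | no  g≢e | no  g≢f = exchange-other g≢e g≢f

  exchange-invariant : ∀ {A : Set} (k : Fin m → A) → k e ≡ k f → ∀ g → k (exchange g) ≡ k g
  exchange-invariant k ke≡kf g with g ≟ᶠ e | g ≟ᶠ f
  ... | yes g≡e | _       = trans (sym ke≡kf) (sym (cong k g≡e))
  ... | no  _   | yes g≡f = trans ke≡kf (sym (cong k g≡f))
  ... | no  _   | no  _   = refl

module _ (D : Digraph) (e f : Fin (Digraph.size D)) where
  open Digraph D
  open Exchange e f

  exchangeHeads : Digraph
  exchangeHeads = record { order = order ; size = size ; arc = λ g → tail g , head (exchange g) }

  -- The new head of `g` is the old head of `exchange g`, an arc of the same colour. So `φ` fixes
  -- the halves at tails and moves those at heads along `exchange`.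
  tile-exchangeHeads : ∀ {c} (col : EdgeColouring D c) → col e ≡ col f →
                       ∀ x → tile exchangeHeads col x ↭ tile D col x
  tile-exchangeHeads col same = local-isomorphism id φ
    (λ { (g , true) → refl ; (g , false) → cong (λ i → - colour i) (exchange-invariant col same g) })
    (λ { (g , true) → refl ; (g , false) → refl })
    (λ h h′ _ eq → trans (sym (φ-involutive h)) (trans (cong φ eq) (φ-involutive h′)))
    (λ x h at≡x → φ h , trans (at-φ h) at≡x , φ-involutive h)
    where
    open HalfEdges D col using (Half; at)
    φ : Half → Half
    φ (g , true)  = g , true
    φ (g , false) = exchange g , false
    φ-involutive : ∀ h → φ (φ h) ≡ h
    φ-involutive (g , true)  = refl
    φ-involutive (g , false) = cong (_, false) (exchange-involutive g)
    at-φ : ∀ h → HalfEdges.at exchangeHeads col (φ h) ≡ at h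
    at-φ (g , true)  = refl
    at-φ (g , false) = cong head (exchange-involutive g)

-- The cube

-- The ends of the edges, in the order of `cubeEdges`, sorted by the parity of the coordinate sum.
even odd : Fin 12 → Fin 8
even = lookup (0F ∷ 0F ∷ 0F ∷ 3F ∷ 5F ∷ 3F ∷ 6F ∷ 3F ∷ 5F ∷ 6F ∷ 5F ∷ 6F ∷ [])
odd  = lookup (1F ∷ 2F ∷ 4F ∷ 1F ∷ 1F ∷ 2F ∷ 2F ∷ 7F ∷ 4F ∷ 4F ∷ 7F ∷ 7F ∷ [])

parity : Fin 8 → Bool
parity = lookup (false ∷ true ∷ true ∷ false ∷ true ∷ false ∷ false ∷ true ∷ [])

-- Vertices are numbered in binary; direction i changes the bit of weight 2 ^ i.
flip : Fin 3 → Fin 8 → Fin 8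
flip 0F = lookup (1F ∷ 0F ∷ 3F ∷ 2F ∷ 5F ∷ 4F ∷ 7F ∷ 6F ∷ [])
flip 1F = lookup (2F ∷ 3F ∷ 0F ∷ 1F ∷ 6F ∷ 7F ∷ 4F ∷ 5F ∷ [])
flip 2F = lookup (4F ∷ 5F ∷ 6F ∷ 7F ∷ 0F ∷ 1F ∷ 2F ∷ 3F ∷ [])

edge : Fin 8 → Fin 3 → Fin 12
edge x 0F = lookup (0F ∷ 0F ∷ 5F ∷ 5F ∷ 8F ∷ 8F ∷ # 11 ∷ # 11 ∷ []) x
edge x 1F = lookup (1F ∷ 3F ∷ 1F ∷ 3F ∷ 9F ∷ # 10 ∷ 9F ∷ # 10 ∷ []) x
edge x 2F = lookup (2F ∷ 4F ∷ 6F ∷ 7F ∷ 2F ∷ 4F ∷ 6F ∷ 7F ∷ []) x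

infix 4 _≟ₚ_ _≈ᵤ?_
_≟ₚ_ : (p q : Fin 8 × Fin 8) → Dec (p ≡ q)
_≟ₚ_ = ≡-dec _≟ᶠ_ _≟ᶠ_

_≈ᵤ?_ : (p q : Fin 8 × Fin 8) → Dec (p ≈ᵤ q)
p ≈ᵤ? q = (p ≟ₚ q) ⊎-dec (swap p ≟ₚ q)

abstract
  ends-Q : ∀ e → Graph.ends Q e ≈ᵤ (even e , odd e)
  ends-Q = from-yes (all? λ e → Graph.ends Q e ≈ᵤ? (even e , odd e))

  edge-ends : ∀ x i → (even (edge x i) , odd (edge x i)) ≈ᵤ (x , flip i x)
  edge-ends = from-yes (all? λ x → all? λ i → (even (edge x i) , odd (edge x i)) ≈ᵤ? (x , flip i x))

  parity-ends : ∀ e → parity (even e) ≡ false × parity (odd e) ≡ true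
  parity-ends = from-yes (all? λ e → (parity (even e) ≟ᵇ false) ×-dec (parity (odd e) ≟ᵇ true))

  even-odd-injective : ∀ e f → (even e , odd e) ≡ (even f , odd f) → e ≡ f
  even-odd-injective = from-yes (all? λ e → all? λ f → ((even e , odd e) ≟ₚ (even f , odd f)) →-dec (e ≟ᶠ f))

  edge-incident : ∀ x e → (even e ≡ x) ⊎ (odd e ≡ x) → ∃[ i ] edge x i ≡ e
  edge-incident = from-yes (all? λ x → all? λ e → ((even e ≟ᶠ x) ⊎-dec (odd e ≟ᶠ x)) →-dec any? λ i → edge x i ≟ᶠ e)

module Detour (e f : Fin 12) where

  Avoids : Fin 12 → Set
  Avoids g = g ≢ e × g ≢ f

  avoids? : ∀ g → Dec (Avoids g)
  avoids? g = ¬? (g ≟ᶠ e) ×-dec ¬? (g ≟ᶠ f)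

  AdjacentAvoiding : Fin 8 → Fin 8 → Set
  AdjacentAvoiding x y = ∃[ g ] Avoids g × (even g , odd g) ≈ᵤ (x , y)

-- An edge lies in two 4-cycles that have only this edge in common.
abstract
  detour : ∀ e f x i → let open Detour e f in
           Avoids (edge x i) ⊎ ∃[ j ] Avoids (edge x j) × Avoids (edge (flip j x) i) × Avoids (edge (flip i x) j)
             × flip j (flip i x) ≡ flip i (flip j x)
  detour = from-yes (all? λ e → all? λ f → all? λ x → all? λ i → let open Detour e f in
    avoids? (edge x i) ⊎-dec any? λ j → avoids? (edge x j) ×-dec avoids? (edge (flip j x) i)
      ×-dec avoids? (edge (flip i x) j) ×-dec (flip j (flip i x) ≟ᶠ flip i (flip j x)))

  ends-direction : ∀ x y e → (even e , odd e) ≈ᵤ (x , y) → ∃[ i ] flip i x ≡ y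
  ends-direction = from-yes (all? λ x → all? λ y → all? λ e → ((even e , odd e) ≈ᵤ? (x , y)) →-dec any? λ i → flip i x ≟ᶠ y)

adjacent-direction : ∀ {x y} → Adjacent (Graph.ends Q) x y → ∃[ i ] flip i x ≡ y
adjacent-direction {x} {y} (e , eq) = ends-direction x y e (≈ᵤ-trans (≈ᵤ-sym (ends-Q e)) eq)

-- A step of a path in the cube that cannot be kept is replaced by the other three sides of a square
-- through it, the last of them traversed backwards.
connected-avoiding : ∀ e f x y → Star (Detour.AdjacentAvoiding e f) x y
connected-avoiding e f x y = (reroute ⋆) (Graph.connected Q x y)
  where
  open Detour e f
  step : ∀ x i → Avoids (edge x i) → AdjacentAvoiding x (flip i x)
  step x i av = edge x i , av , edge-ends x i
  backwards : ∀ {x y} → AdjacentAvoiding x y → AdjacentAvoiding y x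
  backwards (g , av , eq) = g , av , ≈ᵤ-trans eq (inj₂ refl)
  reroute : ∀ {x y} → Adjacent (Graph.ends Q) x y → Star AdjacentAvoiding x y
  reroute {x} adj with i , refl ← adjacent-direction adj | detour e f x i
  ... | inj₁ av = step x i av ◅ ε
  ... | inj₂ (j , av₁ , av₂ , av₃ , square) =
    step x j av₁ ◅ step (flip j x) i av₂
    ◅ subst (λ z → AdjacentAvoiding z (flip i x)) square (backwards (step (flip i x) j av₃)) ◅ ε

parity-adjacent : ∀ {x y} g → (even g , odd g) ≈ᵤ (x , y) → parity x ≢ parity y
parity-adjacent g (inj₁ refl) eq = case trans (sym (proj₁ (parity-ends g))) (trans eq (proj₂ (parity-ends g))) of λ ()
parity-adjacent g (inj₂ refl) eq = case trans (sym (proj₂ (parity-ends g))) (trans eq (proj₁ (parity-ends g))) of λ ()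

-- `opposite` is the antipodal map of the cube.
infix 4 _≋_ _≋?_
_≋_ : Fin 12 → Fin 12 → Set
e ≋ f = even e ≡ even f ⊎ odd e ≡ odd f ⊎ (opposite (even e) ≡ odd f × opposite (odd e) ≡ even f)

_≋?_ : ∀ e f → Dec (e ≋ f)
e ≋? f = (even e ≟ᶠ even f) ⊎-dec (odd e ≟ᶠ odd f) ⊎-dec ((opposite (even e) ≟ᶠ odd f) ×-dec (opposite (odd e) ≟ᶠ even f))

abstract
  -- Two edges that neither share an end nor are antipodal are joined by a third edge, from the even
  -- end of one to the odd end of the other. An exchange of heads would double it.
  no-third-edge⇒≋ : ∀ e f → (∀ g → g ≢ e → g ≢ f → (even g , odd g) ≢ (even e , odd f)) →
                    (∀ g → g ≢ f → g ≢ e → (even g , odd g) ≢ (even f , odd e)) → e ≋ f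
  no-third-edge⇒≋ = from-yes (all? λ e → all? λ f →
    (all? λ g → ¬? (g ≟ᶠ e) →-dec ¬? (g ≟ᶠ f) →-dec ¬? ((even g , odd g) ≟ₚ (even e , odd f))) →-dec
    (all? λ g → ¬? (g ≟ᶠ f) →-dec ¬? (g ≟ᶠ e) →-dec ¬? ((even g , odd g) ≟ₚ (even f , odd e))) →-dec (e ≋? f))

-- Edges of the same colour in a 3-realization of the cube

module Rigid (P : Pot) (unique : ¬ (∃[ H ] P Realizes H × ¬ (H ≃ Q) × Graph.order H ≤ 8))
             (O : Orientation Q) {c : ℕ} (col : EdgeColouring (Orientation.digraph O) c)
             (sub : ∀ x → tile (Orientation.digraph O) col x ∈ₚ P) where

  open Orientation O using (arc; orients)
  D : Digraph
  D = Orientation.digraph O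
  open Digraph D using (tail; head)
  open HalfEdges D col

  arc-ends : ∀ g → arc g ≈ᵤ (even g , odd g)
  arc-ends g = ≈ᵤ-trans (orients g) (ends-Q g)

  module _ {e f : Fin 12} (e≢f : e ≢ f) (same : col e ≡ col f) where
    private
      open Exchange e f
      open Detour e f
      D′ = exchangeHeads D e f

      connected′ : Connected (Digraph.arc D′)
      connected′ x y = Star.map edge′ (connected-avoiding e f x y)
        where
        edge′ : ∀ {x y} → AdjacentAvoiding x y → Adjacent (Digraph.arc D′) x y
        edge′ (g , (g≢e , g≢f) , eq) = g ,
          subst (λ h → (tail g , head h) ≈ᵤ _) (sym (exchange-other g≢e g≢f)) (≈ᵤ-trans (arc-ends g) eq)

      H : Graph
      H = record { order = 8 ; size = 12 ; ends = Digraph.arc D′ ; nonEmpty = _ ; connected = connected′ }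

      realizes-H : P Realizes H
      realizes-H = realizes P (record { arc = Digraph.arc D′ ; orients = λ _ → inj₁ refl }) col
        λ x → ∈ₚ-resp-↭ P (↭-sym (tile-exchangeHeads D e f col same x)) (sub x)

      exchanged : (tail e , head f) ≡ Digraph.arc D′ e
      exchanged = cong (λ h → tail e , head h) (sym exchange-e)

    -- Only the double negation follows from `unique`; it suffices, because the isomorphism serves
    -- refutations alone.
    ¬¬iso : ¬ ¬ (H ≃ Q)
    ¬¬iso H≄Q = unique (H , realizes-H , H≄Q , ℕₚ.≤-refl)

    private
      -- A second 2-colouring of the cube minus e and f differs from parity by a constant.
      colouring-parity : (s : Fin 8 → Bool) → (∀ {x y} → AdjacentAvoiding x y → s x ≢ s y) →
                         ∀ {x y} → Star AdjacentAvoiding x y → s x xor parity x ≡ s y xor parity y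
      colouring-parity s proper ε = refl
      colouring-parity s proper {x} {z} (_◅_ {j = y} adj@(g , _ , eq) path) =
        trans (xor-not (proper adj) (parity-adjacent g eq)) (colouring-parity s proper path)
        where
        xor-not : ∀ {a b c d} → a ≢ c → b ≢ d → a xor b ≡ c xor d
        xor-not {c = c} {d} a≢c b≢d = trans (cong₂ _xor_ (¬-not a≢c) (¬-not b≢d)) (xor-annihilates-not c d)

    -- Pulled back along an isomorphism, the parity becomes a 2-colouring `s` of the new graph. It
    -- agrees with the parity up to a constant, since the cube without `e` and `f` is connected, and
    -- it separates `tail e` from `head f`, which the new graph joins.
    tail-head-parity : parity (tail e) ≢ parity (head f)
    tail-head-parity same-parity = ¬¬iso λ H≃Q → let open Iso H≃Q in
      s-arc e (subst₂ (λ x y → s x ≡ s y) (cong proj₁ exchanged) (cong proj₂ exchanged)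
        (xor-cancelʳ (trans (colouring-parity s s-proper (connected-avoiding e f (tail e) (head f))) (cong (s (head f) xor_) (sym same-parity)))))
      where
      xor-cancelʳ : ∀ {a b c} → a xor c ≡ b xor c → a ≡ b
      xor-cancelʳ {false} {false} _ = refl
      xor-cancelʳ {true} {true} _ = refl
      xor-cancelʳ {true} {false} {false} ()
      xor-cancelʳ {true} {false} {true} ()
      xor-cancelʳ {false} {true} {false} ()
      xor-cancelʳ {false} {true} {true} ()
      module Iso (H≃Q : H ≃ Q) where
        open _≃_ H≃Q
        s : Fin 8 → Bool
        s = parity ∘ Bijection.to vertices
        s-arc : ∀ g → s (proj₁ (Digraph.arc D′ g)) ≢ s (proj₂ (Digraph.arc D′ g))
        s-arc g = parity-adjacent (Bijection.to edges g) (≈ᵤ-sym (≈ᵤ-trans (ends g) (ends-Q (Bijection.to edges g))))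
        s-proper : ∀ {x y} → AdjacentAvoiding x y → s x ≢ s y
        s-proper (g , (g≢e , g≢f) , eq) with ≈ᵤ-trans (arc-ends g) eq | exchange-other g≢e g≢f
        ... | inj₁ refl | eq′ = λ p → s-arc g (trans p (cong (s ∘ head) (sym eq′)))
        ... | inj₂ refl | eq′ = λ p → s-arc g (trans (sym p) (cong (s ∘ head) (sym eq′)))

    -- In the new graph `e` runs from `tail e` to `head f` while `g` keeps its ends, so the two
    -- would be parallel.
    no-third-edge : ∀ {g} → g ≢ e → g ≢ f → ¬ (arc g ≈ᵤ (tail e , head f))
    no-third-edge {g} g≢e g≢f parallel = ¬¬iso λ H≃Q → let open _≃_ H≃Q in
      g≢e (Bijection.injective edges (Q-simple
        (≈ᵤ-trans (≈ᵤ-sym (ends g)) (≈ᵤ-trans (≈ᵤ-map (Bijection.to vertices)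
          (≈ᵤ-trans (inj₁ (cong (λ h → tail g , head h) (exchange-other g≢e g≢f))) (≈ᵤ-trans parallel (inj₁ exchanged)))) (ends e)))))
      where
      Q-simple : ∀ {a b} → Graph.ends Q a ≈ᵤ Graph.ends Q b → a ≡ b
      Q-simple {a} {b} eq with ≈ᵤ-trans (≈ᵤ-sym (ends-Q a)) (≈ᵤ-trans eq (ends-Q b))
      ... | inj₁ eq′ = even-odd-injective a b eq′
      ... | inj₂ eq′ = case trans (sym (proj₂ (parity-ends a))) (trans (cong (parity ∘ proj₁) eq′) (proj₁ (parity-ends b))) of λ ()

  parity-head : ∀ e → parity (head e) ≡ not (parity (tail e))
  parity-head e with arc e | arc-ends e | parity-ends e
  ... | _ | inj₁ refl | p , q = trans q (cong not (sym p))
  ... | _ | inj₂ refl | p , q = trans p (cong not (sym q))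

  sameColour⇒≋ : ∀ {e f} → col e ≡ col f → e ≋ f × parity (tail e) ≡ parity (tail f)
  sameColour⇒≋ {e} {f} same with e ≟ᶠ f
  ... | yes refl = inj₁ refl , refl
  ... | no e≢f = no-third-edge⇒≋ e f
        (λ g g≢e g≢f → aligned {e} {f} (arc e) (arc f) (arc-ends e) (arc-ends f) tails g (third g≢e g≢f) (third′ g≢f g≢e))
        (λ g g≢f g≢e → aligned {f} {e} (arc f) (arc e) (arc-ends f) (arc-ends e) (sym tails) g (third′ g≢f g≢e) (third g≢e g≢f))
      , tails
    where
    f≢e : f ≢ e
    f≢e = e≢f ∘ sym
    tails : parity (tail e) ≡ parity (tail f)
    tails = not-injective (trans (sym (¬-not (tail-head-parity {e} {f} e≢f same ∘ sym))) (parity-head f))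
    third : ∀ {g} → g ≢ e → g ≢ f → ¬ (arc g ≈ᵤ (tail e , head f))
    third = no-third-edge {e} {f} e≢f same
    third′ : ∀ {g} → g ≢ f → g ≢ e → ¬ (arc g ≈ᵤ (tail f , head e))
    third′ = no-third-edge {f} {e} f≢e (sym same)
    -- Tails of equal parity leave two cases. If both arcs leave even vertices, the pair in question
    -- runs from the tail of the first to the head of the second; if both leave odd vertices, from
    -- the head of the first to the tail of the second.
    aligned : ∀ {e f} (a b : Fin 8 × Fin 8) → a ≈ᵤ (even e , odd e) → b ≈ᵤ (even f , odd f) →
              parity (proj₁ a) ≡ parity (proj₁ b) → ∀ g →
              ¬ (arc g ≈ᵤ (proj₁ a , proj₂ b)) → ¬ (arc g ≈ᵤ (proj₁ b , proj₂ a)) →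
              (even g , odd g) ≢ (even e , odd f)
    aligned _ _ (inj₁ refl) (inj₁ refl) _ g no₁ no₂ eq = no₁ (≈ᵤ-trans (arc-ends g) (inj₁ eq))
    aligned _ _ (inj₂ refl) (inj₂ refl) _ g no₁ no₂ eq = no₂ (≈ᵤ-trans (arc-ends g) (≈ᵤ-trans (inj₁ eq) (inj₂ refl)))
    aligned {e} {f} _ _ (inj₁ refl) (inj₂ refl) p _ _ _ _ =
      case trans (sym (proj₁ (parity-ends e))) (trans p (proj₂ (parity-ends f))) of λ ()
    aligned {e} {f} _ _ (inj₂ refl) (inj₁ refl) p _ _ _ _ =
      case trans (sym (proj₂ (parity-ends e))) (trans p (proj₁ (parity-ends f))) of λ ()

  parity-at : ∀ {e f} b → parity (tail e) ≡ parity (tail f) → parity (at (e , b)) ≡ parity (at (f , b))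
  parity-at true  eq = eq
  parity-at {e} {f} false eq = trans (parity-head e) (trans (cong not eq) (sym (parity-head f)))

  half-at : ∀ x i → ∃[ b ] at (edge x i , b) ≡ x
  half-at x i with arc (edge x i) in eq | ≈ᵤ-trans (arc-ends (edge x i)) (edge-ends x i)
  ... | _ | inj₁ refl = true , cong proj₁ eq
  ... | _ | inj₂ refl = false , cong proj₂ eq

  at-edge : ∀ {x} h → at h ≡ x → ∃[ j ] edge x j ≡ proj₁ h
  at-edge (e , b) refl = edge-incident _ e (incident b (arc-ends e))
    where
    incident : ∀ b → arc e ≈ᵤ (even e , odd e) → even e ≡ at (e , b) ⊎ odd e ≡ at (e , b)
    incident true  (inj₁ eq) = inj₁ (sym (cong proj₁ eq))
    incident true  (inj₂ eq) = inj₂ (sym (cong proj₂ eq))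
    incident false (inj₁ eq) = inj₂ (sym (cong proj₂ eq))
    incident false (inj₂ eq) = inj₁ (sym (cong proj₁ eq))

  module _ {x u} (x↭u : tile D col x ↭ tile D col u) where

    private
      -- The label of the half of `edge x i` at `x` occurs at `u` too. Its sign fixes tail or head,
      -- and all arcs of one colour have the same direction with respect to parity, so `x` and `u`
      -- lie on the same side.
      partner : ∀ i → ∃[ j ] col (edge x i) ≡ col (edge u j) × parity x ≡ parity u
      partner i
        with b , at≡x ← half-at x i
        with (f , b′) , at≡u , eq ← ∈-tile⁻ (∈-resp-↭ x↭u (subst (λ y → label (edge x i , b) ∈ tile D col y) at≡x (∈-tile (edge x i , b))))
        with same , refl ← label≡⇒ (f , b′) (edge x i , b) eq
        with j , refl ← at-edge (f , b′) at≡u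
        = j , sym same , trans (cong parity (sym at≡x))
            (trans (parity-at {edge x i} {f} b (sym (proj₂ (sameColour⇒≋ {f} {edge x i} same)))) (cong parity at≡u))

    sameTile⇒sameParity : parity x ≡ parity u
    sameTile⇒sameParity = proj₂ (proj₂ (partner 0F))

    sameTile⇒sameColours : ∀ i → ∃[ j ] col (edge x i) ≡ col (edge u j)
    sameTile⇒sameColours i = Product.map₂ proj₁ (partner i)

-- At least six tiles

lookup-injective : ∀ {A : Set} {xs : List A} → AllPairs _≢_ xs → ∀ {i j} → List.lookup xs i ≡ List.lookup xs j → i ≡ j
lookup-injective (x∉ ∷ xs!) {0F}        {0F}        eq = refl
lookup-injective (x∉ ∷ xs!) {0F}        {Fin.suc j} eq = contradiction eq (All.lookup x∉ (∈-lookup j))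
lookup-injective (x∉ ∷ xs!) {Fin.suc i} {0F}        eq = contradiction (sym eq) (All.lookup x∉ (∈-lookup i))
lookup-injective (x∉ ∷ xs!) {Fin.suc i} {Fin.suc j} eq = cong Fin.suc (lookup-injective xs! eq)

pairwise-distinct⇒length≤ : ∀ {A : Set} {k} (f : A → Fin k) {xs : List A} →
                            AllPairs (λ x y → f x ≢ f y) xs → length xs ≤ k
pairwise-distinct⇒length≤ {A} {k} f {xs} distinct = subst (_≤ k) (length-map f xs)
  (injective⇒≤ {f = List.lookup (List.map f xs)} (lookup-injective (AllPairsₚ.map⁺ distinct)))

vertex : Bool → Fin 4 → Fin 8
vertex false = lookup (0F ∷ 3F ∷ 5F ∷ 6F ∷ [])
vertex true  = lookup (7F ∷ 4F ∷ 2F ∷ 1F ∷ [])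

-- This changes the two coordinates other than `m`. The three choices of `m` give the three perfect
-- matchings of the four vertices of a side.
twin : Fin 3 → Fin 8 → Fin 8
twin m x = opposite (flip m x)

abstract
  parity-vertex : ∀ s p → parity (vertex s p) ≡ s
  parity-vertex false = from-yes (all? λ p → parity (vertex false p) ≟ᵇ false)
  parity-vertex true  = from-yes (all? λ p → parity (vertex true p) ≟ᵇ true)

  vertex-injective : ∀ s p q → vertex s p ≡ vertex s q → p ≡ q
  vertex-injective false = from-yes (all? λ p → all? λ q → (vertex false p ≟ᶠ vertex false q) →-dec (p ≟ᶠ q))
  vertex-injective true  = from-yes (all? λ p → all? λ q → (vertex true p ≟ᶠ vertex true q) →-dec (p ≟ᶠ q))

  parity-flip : ∀ a x → parity (flip a x) ≡ not (parity x)
  parity-flip = from-yes (all? λ a → all? λ x → parity (flip a x) ≟ᵇ not (parity x))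

  edge-flip : ∀ a x → edge (flip a x) a ≡ edge x a
  edge-flip = from-yes (all? λ a → all? λ x → edge (flip a x) a ≟ᶠ edge x a)

  -- On the side opposite to `y`, the matching `twin m` pairs the antipode of `y` with one neighbour
  -- of `y`, hence the other two neighbours with each other.
  common-neighbour : ∀ m y → ∃[ a ] ∃[ b ] a ≢ b × twin m (flip a y) ≡ flip b y
  common-neighbour = from-yes (all? λ m → all? λ y → any? λ a → any? λ b → ¬? (a ≟ᶠ b) ×-dec (twin m (flip a y) ≟ᶠ flip b y))

  vertex-parity : ∀ x → ∃[ p ] x ≡ vertex (parity x) p
  vertex-parity = from-yes (all? λ x → any? λ p → x ≟ᶠ vertex (parity x) p)

  -- The edge from `x` to the antipode of `u` works: a related edge at `u` must be antipodal to it,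
  -- a related edge at `w` must share its end other than `x`, and these two are unrelated.
  three-vertices-apart : ∀ x u w → parity x ≡ parity u → parity x ≡ parity w → x ≢ u → x ≢ w → u ≢ w →
    ∃[ i ] ∀ j k → ¬ (edge x i ≋ edge u j × edge x i ≋ edge w k × edge u j ≋ edge w k)
  three-vertices-apart = from-yes (all? λ x → all? λ u → all? λ w →
    (parity x ≟ᵇ parity u) →-dec (parity x ≟ᵇ parity w) →-dec ¬? (x ≟ᶠ u) →-dec ¬? (x ≟ᶠ w) →-dec ¬? (u ≟ᶠ w) →-dec
    any? λ i → all? λ j → all? λ k → ¬? ((edge x i ≋? edge u j) ×-dec (edge x i ≋? edge w k) ×-dec (edge u j ≋? edge w k)))

  -- The only edge at `flip b y` related to `edge y a` is the one to `y`, and no edge at another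
  -- vertex of the side of `y` is related to two edges at `y`.
  star-apart : ∀ y z a b → parity y ≡ parity z → y ≢ z → a ≢ b →
    ∀ j k → ¬ (edge y a ≋ edge (flip b y) j × edge y a ≋ edge z k × edge (flip b y) j ≋ edge z k)
  star-apart = from-yes (all? λ y → all? λ z → all? λ a → all? λ b →
    (parity y ≟ᵇ parity z) →-dec ¬? (y ≟ᶠ z) →-dec ¬? (a ≟ᶠ b) →-dec
    all? λ j → all? λ k → ¬? ((edge y a ≋? edge (flip b y) j) ×-dec (edge y a ≋? edge z k) ×-dec (edge (flip b y) j ≋? edge z k)))

module Tiles (P : Pot) (unique : ¬ (∃[ H ] P Realizes H × ¬ (H ≃ Q) × Graph.order H ≤ 8))
             (O : Orientation Q) {c : ℕ} (col : EdgeColouring (Orientation.digraph O) c)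
             (sub : ∀ x → tile (Orientation.digraph O) col x ∈ₚ P) where

  open Rigid P unique O col sub

  tileIndex : Fin 8 → Fin ∣ P ∣ₚ
  tileIndex x = index (sub x)

  infix 4 _~_ _~?_ _≁_
  _~_ _≁_ : Fin 8 → Fin 8 → Set
  x ~ u = tileIndex x ≡ tileIndex u
  x ≁ u = ¬ x ~ u

  _~?_ : ∀ x u → Dec (x ~ u)
  x ~? u = tileIndex x ≟ᶠ tileIndex u

  ~⇒↭ : ∀ x u → x ~ u → tile D col x ↭ tile D col u
  ~⇒↭ x u = Membershipₛ.index-injective ↭-setoid (sub x) (sub u)

  ~⇒sameParity : ∀ x u → x ~ u → parity x ≡ parity u
  ~⇒sameParity x u x~u = sameTile⇒sameParity (~⇒↭ x u x~u)

  ~⇒sameColours : ∀ x u → x ~ u → ∀ i → ∃[ j ] col (edge x i) ≡ col (edge u j)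
  ~⇒sameColours x u x~u = sameTile⇒sameColours (~⇒↭ x u x~u)

  colour-triangle : ∀ e f g → col e ≡ col f → col e ≡ col g → e ≋ f × e ≋ g × f ≋ g
  colour-triangle e f g e=f e=g = proj₁ (sameColour⇒≋ {e} {f} e=f) , proj₁ (sameColour⇒≋ {e} {g} e=g) ,
    proj₁ (sameColour⇒≋ {f} {g} (trans (sym e=f) e=g))

  at-most-two-equal-tiles : ∀ x u w → x ≢ u → x ≢ w → u ≢ w → x ~ u → x ≁ w
  at-most-two-equal-tiles x u w x≢u x≢w u≢w x~u x~w =
    let i , apart = three-vertices-apart x u w (~⇒sameParity x u x~u) (~⇒sameParity x w x~w) x≢u x≢w u≢w
        j , same₁ = ~⇒sameColours x u x~u i
        k , same₂ = ~⇒sameColours x w x~w i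
    in apart j k (colour-triangle (edge x i) (edge u j) (edge w k) same₁ same₂)

  -- The edge between `y` and `flip a y` belongs to both stars, so its colour would recur at
  -- `flip b y` and at `z`, against `star-apart`.
  common-neighbour-tile : ∀ y z a b → a ≢ b → flip a y ~ flip b y → y ≢ z → y ≁ z
  common-neighbour-tile y z a b a≢b x~u y≢z y~z =
    let j , same₁ = ~⇒sameColours (flip a y) (flip b y) x~u a
        k , same₂ = ~⇒sameColours y z y~z a
    in star-apart y z a b (~⇒sameParity y z y~z) y≢z a≢b j k
         (colour-triangle (edge y a) (edge (flip b y) j) (edge z k)
            (trans (cong col (sym (edge-flip a y))) same₁) same₂)

  Three : Bool → Set
  Three s = ∃[ p ] ∃[ q ] ∃[ r ] AllPairs _≁_ (vertex s p ∷ vertex s q ∷ vertex s r ∷ [])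

  Twins : Bool → Set
  Twins s = ∃[ m ] ∀ p → vertex s p ~ twin m (vertex s p)

  three : ∀ s {p q r} → vertex s p ≁ vertex s q → vertex s p ≁ vertex s r → vertex s q ≁ vertex s r → Three s
  three s p≁q p≁r q≁r = _ , _ , _ , (p≁q ∷ p≁r ∷ []) ∷ (q≁r ∷ []) ∷ [] ∷ []

  twins₂ : ∀ s → vertex s 0F ~ vertex s 1F → vertex s 2F ~ vertex s 3F → Twins s
  twins₂ false p q = 2F , λ { 0F → p ; 1F → sym p ; 2F → q ; 3F → sym q }
  twins₂ true  p q = 2F , λ { 0F → p ; 1F → sym p ; 2F → q ; 3F → sym q }

  twins₁ : ∀ s → vertex s 0F ~ vertex s 2F → vertex s 1F ~ vertex s 3F → Twins s
  twins₁ false p q = 1F , λ { 0F → p ; 1F → q ; 2F → sym p ; 3F → sym q }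
  twins₁ true  p q = 1F , λ { 0F → p ; 1F → q ; 2F → sym p ; 3F → sym q }

  twins₀ : ∀ s → vertex s 0F ~ vertex s 3F → vertex s 1F ~ vertex s 2F → Twins s
  twins₀ false p q = 0F , λ { 0F → p ; 1F → q ; 2F → sym q ; 3F → sym p }
  twins₀ true  p q = 0F , λ { 0F → p ; 1F → q ; 2F → sym q ; 3F → sym p }

  -- By `lone`, at most two of the four vertices of a side share a tile. So there are three
  -- different tiles, or the vertices fall into two pairs.
  three-or-twins : ∀ s → Three s ⊎ Twins s
  three-or-twins s = case (v 0F ~? v 1F) ,′ (v 2F ~? v 3F) of λ where
      (yes 0~1 , yes 2~3) → inj₂ (twins₂ s 0~1 2~3)
      (yes 0~1 , no 2≁3)  → inj₁ (three s (lone {0F} {1F} {2F} (λ ()) (λ ()) (λ ()) 0~1) (lone {0F} {1F} {3F} (λ ()) (λ ()) (λ ()) 0~1) 2≁3)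
      (no 0≁1 , yes 2~3)  → inj₁ (three s 0≁1 (lone {2F} {3F} {0F} (λ ()) (λ ()) (λ ()) 2~3 ∘ sym) (lone {2F} {3F} {1F} (λ ()) (λ ()) (λ ()) 2~3 ∘ sym))
      (no 0≁1 , no 2≁3)   → case (v 0F ~? v 2F) ,′ (v 1F ~? v 3F) of λ where
        (yes 0~2 , yes 1~3) → inj₂ (twins₁ s 0~2 1~3)
        (yes 0~2 , no 1≁3)  → inj₁ (three s 0≁1 (lone {0F} {2F} {3F} (λ ()) (λ ()) (λ ()) 0~2) 1≁3)
        (no 0≁2 , b)        → case (v 1F ~? v 2F) ,′ (v 0F ~? v 3F) of λ where
          (no 1≁2 , _)       → inj₁ (three s 0≁1 0≁2 1≁2)
          (yes 1~2 , yes 0~3) → inj₂ (twins₀ s 0~3 1~2)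
          (yes 1~2 , no 0≁3)  → inj₁ (three s 0≁1 0≁3 (lone {1F} {2F} {3F} (λ ()) (λ ()) (λ ()) 1~2))
    where
    v : Fin 4 → Fin 8
    v = vertex s
    lone : ∀ {p q r} → p ≢ q → p ≢ r → q ≢ r → v p ~ v q → v p ≁ v r
    lone p≢q p≢r q≢r = at-most-two-equal-tiles _ _ _ (p≢q ∘ vertex-injective s _ _) (p≢r ∘ vertex-injective s _ _) (q≢r ∘ vertex-injective s _ _)

  -- Equal tiles force equal parity, so the tiles of the two sides can be counted separately.
  six : ∀ s {xs ys} → AllPairs _≁_ xs → AllPairs _≁_ ys →
        All (λ x → parity x ≡ s) xs → All (λ y → parity y ≡ not s) ys → length (xs ++ ys) ≤ ∣ P ∣ₚ
  six s {xs} {ys} xs! ys! xs-s ys-s = pairwise-distinct⇒length≤ tileIndex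
    (AllPairsₚ.++⁺ xs! ys! (All.map (λ {x} px → All.map (λ {y} py → separated x y px py) ys-s) xs-s))
    where
    separated : ∀ x y → parity x ≡ s → parity y ≡ not s → x ≁ y
    separated x y px py x~y = not-¬ refl (trans (sym px) (trans (~⇒sameParity x y x~y) py))

  -- Every vertex of the other side has two neighbours that are twins, so it shares its tile with no
  -- vertex of its side. These four tiles are joined by two from side `s`, where three vertices
  -- never agree.
  six-of-twins : ∀ s → Twins s → 6 ≤ ∣ P ∣ₚ
  six-of-twins s (m , twins) = case two of λ (p , q , p≁q) →
    six s {vertex s p ∷ vertex s q ∷ []} {List.tabulate (vertex (not s))}
      ((p≁q ∷ []) ∷ [] ∷ [])
      (AllPairsₚ.tabulate⁺ λ {i} {j} i≢j → lonely (vertex (not s) i) (vertex (not s) j) (parity-vertex (not s) i) (i≢j ∘ vertex-injective (not s) _ _))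
      (parity-vertex s p ∷ parity-vertex s q ∷ [])
      (Allₚ.tabulate⁺ {f = vertex (not s)} (parity-vertex (not s)))
    where
    two : ∃[ p ] ∃[ q ] vertex s p ≁ vertex s q
    two with vertex s 0F ~? vertex s 1F
    ... | no  0≁1 = 0F , 1F , 0≁1
    ... | yes 0~1 = 0F , 2F , at-most-two-equal-tiles _ _ _ (≢v (λ ())) (≢v (λ ())) (≢v (λ ())) 0~1
      where
      ≢v : ∀ {p q} → p ≢ q → vertex s p ≢ vertex s q
      ≢v p≢q = p≢q ∘ vertex-injective s _ _
    lonely : ∀ y z → parity y ≡ not s → y ≢ z → y ≁ z
    lonely y z py y≢z =
      let a , b , a≢b , eq = common-neighbour m y
          p , v≡ = vertex-parity (flip a y)
          side = trans (parity-flip a y) (trans (cong not py) (not-involutive s))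
          x≡ = trans v≡ (cong (λ t → vertex t p) side)
      in common-neighbour-tile y z a b a≢b
           (trans (subst (λ x → x ~ twin m x) (sym x≡) (twins p)) (cong tileIndex eq)) y≢z

  six≤∣P∣ : 6 ≤ ∣ P ∣ₚ
  six≤∣P∣ with three-or-twins false | three-or-twins true
  ... | inj₁ (p , q , r , xs!) | inj₁ (p′ , q′ , r′ , ys!) =
    six false xs! ys! (parity-vertex false p ∷ parity-vertex false q ∷ parity-vertex false r ∷ [])
                      (parity-vertex true p′ ∷ parity-vertex true q′ ∷ parity-vertex true r′ ∷ [])
  ... | inj₂ twins | _          = six-of-twins false twins
  ... | inj₁ _     | inj₂ twins = six-of-twins true twins

-- At least five colours

-- The maps a : Fin 12 → Fin 4 with a e ≡ a f → e ≋ f are enumerated edge by edge;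
-- an assignment holds the values chosen so far.
Assignment : Set
Assignment = List (Fin 12 × Fin 4)

Clash : Fin 12 × Fin 4 → Fin 12 × Fin 4 → Set
Clash (e , i) (f , j) = i ≡ j × ¬ (e ≋ f)

clash? : ∀ p q → Dec (Clash p q)
clash? (e , i) (f , j) = (i ≟ᶠ j) ×-dec ¬? (e ≋? f)

ConstantOn : (Fin 12 → Fin 8) → Assignment → Set
ConstantOn end as = All (λ (e , i) → All (λ (f , j) → end e ≡ end f → i ≡ j) as) as

constantOn? : ∀ end as → Dec (ConstantOn end as)
constantOn? end as = All.all? (λ (e , i) → All.all? (λ (f , j) → (end e ≟ᶠ end f) →-dec (i ≟ᶠ j)) as) as

Search : List (Fin 12) → Assignment → Set
Search []       as = ConstantOn even as ⊎ ConstantOn odd as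
Search (e ∷ es) as = ∀ i → Any (Clash (e , i)) as ⊎ Search es ((e , i) ∷ as)

search? : ∀ es as → Dec (Search es as)
search? []       as = constantOn? even as ⊎-dec constantOn? odd as
search? (e ∷ es) as = all? λ i → Any.any? (clash? (e , i)) as ⊎-dec search? es ((e , i) ∷ as)

abstract
  search-allFin : Search (allFin 12) []
  search-allFin = from-yes (search? (allFin 12) [])

-- The branch of the search that follows `a` meets no clash and so reaches a leaf. Decided edges are
-- put in front, whence the reversal `ʳ++`.
search-sound : (a : Fin 12 → Fin 4) → (∀ e f → a e ≡ a f → e ≋ f) → ∀ es fs →
               let as = map (λ e → e , a e) in
               Search es (as fs) → ConstantOn even (as (es ʳ++ fs)) ⊎ ConstantOn odd (as (es ʳ++ fs))
search-sound a a⇒≋ []       fs s = s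
search-sound a a⇒≋ (e ∷ es) fs s with s (a e)
... | inj₁ clash with f , ae≡af , e≭f ← Any.satisfied (Anyₚ.map⁻ clash) = contradiction (a⇒≋ e _ ae≡af) e≭f
... | inj₂ s′ = search-sound a a⇒≋ es (e ∷ fs) s′

-- Pairwise related edges lie in a star or form an antipodal pair, so they number at most three.
-- Four classes cover twelve edges only as four disjoint full stars, whose centres form one side;
-- the search confirms this.
stars : (a : Fin 12 → Fin 4) → (∀ e f → a e ≡ a f → e ≋ f) →
        (∀ e f → even e ≡ even f → a e ≡ a f) ⊎ (∀ e f → odd e ≡ odd f → a e ≡ a f)
stars a a⇒≋ = [ inj₁ ∘ constant even , inj₂ ∘ constant odd ]′ (search-sound a a⇒≋ (allFin 12) [] search-allFin)
  where
  listed : ∀ e → (e , a e) ∈ map (λ e → e , a e) (allFin 12 ʳ++ [])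
  listed e = ∈-map⁺ (λ e → e , a e) (Anyₚ.reverseAcc⁺ [] (allFin 12) (inj₂ (∈-allFin e)))
  constant : ∀ end → ConstantOn end (map (λ e → e , a e) (allFin 12 ʳ++ [])) → ∀ e f → end e ≡ end f → a e ≡ a f
  constant end c e f = All.lookup (All.lookup c (listed e)) (listed f)

-- Three stars give K₃,₃

abstract
  edge-injective : ∀ x i j → edge x i ≡ edge x j → i ≡ j
  edge-injective = from-yes (all? λ x → all? λ i → all? λ j → (edge x i ≟ᶠ edge x j) →-dec (i ≟ᶠ j))

  even-edge-7F : ∀ i j → even (edge (flip i 7F) j) ≡ even (edge 7F i)
  even-edge-7F = from-yes (all? λ i → all? λ j → even (edge (flip i 7F) j) ≟ᶠ even (edge 7F i))

  odd-edge-0F : ∀ i j → odd (edge (flip i 0F) j) ≡ odd (edge 0F i)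
  odd-edge-0F = from-yes (all? λ i → all? λ j → odd (edge (flip i 0F) j) ≟ᶠ odd (edge 0F i))

-- `b i` tells whether the edges at the i-th vertex on the left are directed from the right to the left.
module K₃₃ (b : Fin 3 → Bool) where

  left right : Fin 3 → Fin 6
  left  i = i ↑ˡ 3
  right j = 3 ↑ʳ j

  direct : Bool → Fin 3 × Fin 3 → Fin 6 × Fin 6
  direct true  (i , j) = right j , left i
  direct false (i , j) = left i , right j

  end : Bool → Fin 6 × Fin 6 → Fin 6
  end true  = proj₁
  end false = proj₂

  end-direct-right : ∀ c b p → c ≡ b → end c (direct b p) ≡ right (proj₂ p)
  end-direct-right true  true  p refl = refl
  end-direct-right false false p refl = refl

  end-direct-left : ∀ c b p → c ≢ b → end c (direct b p) ≡ left (proj₁ p)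
  end-direct-left true  true  p c≢b = contradiction refl c≢b
  end-direct-left true  false p c≢b = refl
  end-direct-left false true  p c≢b = refl
  end-direct-left false false p c≢b = contradiction refl c≢b

  arc₃₃ : Fin 9 → Fin 6 × Fin 6
  arc₃₃ e = direct (b (proj₁ (remQuot {3} 3 e))) (remQuot {3} 3 e)

  adjacent : ∀ i j → Adjacent arc₃₃ (left i) (right j) × Adjacent arc₃₃ (right j) (left i)
  adjacent i j = (combine i j , eq) , (combine i j , ≈ᵤ-trans eq (inj₂ refl))
    where
    direct≈ : ∀ b p → direct b p ≈ᵤ (left (proj₁ p) , right (proj₂ p))
    direct≈ true  p = inj₂ refl
    direct≈ false p = inj₁ refl
    eq : arc₃₃ (combine i j) ≈ᵤ (left i , right j)
    eq = subst (λ p → arc₃₃ (combine i j) ≈ᵤ (left (proj₁ p) , right (proj₂ p))) (remQuot-combine {3} {3} i j) (direct≈ _ (remQuot {3} 3 (combine i j)))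

  connected₃₃ : Connected arc₃₃
  connected₃₃ x y = toOrigin x ◅◅ fromOrigin y
    where
    toOrigin : ∀ x → Star (Adjacent arc₃₃) x (left 0F)
    toOrigin 0F = ε
    toOrigin 1F = proj₁ (adjacent 1F 0F) ◅ proj₂ (adjacent 0F 0F) ◅ ε
    toOrigin 2F = proj₁ (adjacent 2F 0F) ◅ proj₂ (adjacent 0F 0F) ◅ ε
    toOrigin 3F = proj₂ (adjacent 0F 0F) ◅ ε
    toOrigin 4F = proj₂ (adjacent 0F 1F) ◅ ε
    toOrigin 5F = proj₂ (adjacent 0F 2F) ◅ ε
    fromOrigin : ∀ x → Star (Adjacent arc₃₃) (left 0F) x
    fromOrigin = Star.reverse (λ (e , eq) → e , ≈ᵤ-trans eq (inj₂ refl)) ∘ toOrigin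

  graph₃₃ : Graph
  graph₃₃ = record { order = 6 ; size = 9 ; ends = arc₃₃ ; nonEmpty = _ ; connected = connected₃₃ }

  orientation₃₃ : Orientation graph₃₃
  orientation₃₃ = record { arc = arc₃₃ ; orients = λ _ → inj₁ refl }

  graph₃₃≄Q : ¬ (graph₃₃ ≃ Q)
  graph₃₃≄Q iso = case ↔⇒≡ (⤖⇒↔ (_≃_.vertices iso)) of λ ()

module Colours (P : Pot) (unique : ¬ (∃[ H ] P Realizes H × ¬ (H ≃ Q) × Graph.order H ≤ 8))
               (O : Orientation Q) {c : ℕ} (col : EdgeColouring (Orientation.digraph O) c)
               (sub : ∀ x → tile (Orientation.digraph O) col x ∈ₚ P) where

  open Rigid P unique O col sub
  open HalfEdges D col

  module _ (w : Fin 8) (mono : ∀ i j → col (edge (flip i w) j) ≡ col (edge w i)) where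

    private
      b : Fin 3 → Bool
      b i = proj₁ (half-at w i)

      open K₃₃ b
      D₃₃ : Digraph
      D₃₃ = Orientation.digraph orientation₃₃

      row column : Fin 9 → Fin 3
      row    = proj₁ ∘ remQuot {3} 3
      column = proj₂ ∘ remQuot {3} 3

      row-column-injective : ∀ {e f} → row e ≡ row f → column e ≡ column f → e ≡ f
      row-column-injective {e} {f} r≡ c≡ =
        trans (sym (combine-remQuot {3} 3 e)) (trans (cong₂ combine r≡ c≡) (combine-remQuot {3} 3 f))

      row-combine : ∀ i j → row (combine i j) ≡ i
      row-combine i j = cong proj₁ (remQuot-combine {3} {3} i j)

      column-combine : ∀ i j → column (combine i j) ≡ j
      column-combine i j = cong proj₂ (remQuot-combine {3} {3} i j)

      col₃₃ : EdgeColouring D₃₃ c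
      col₃₃ e = col (edge w (row e))

      module H = HalfEdges D₃₃ col₃₃

      at-arc : ∀ e c → H.at (e , c) ≡ end c (arc₃₃ e)
      at-arc e true  = refl
      at-arc e false = refl

      at-right : ∀ e c → c ≡ b (row e) → H.at (e , c) ≡ right (column e)
      at-right e c c≡b = trans (at-arc e c) (end-direct-right c _ (remQuot {3} 3 e) c≡b)

      at-left : ∀ e c → c ≢ b (row e) → H.at (e , c) ≡ left (row e)
      at-left e c c≢b = trans (at-arc e c) (end-direct-left c _ (remQuot {3} 3 e) c≢b)

      left≢right : ∀ i j → left i ≢ right j
      left≢right i j eq = case trans (sym (splitAt-↑ˡ 3 i 3)) (trans (cong (splitAt 3) eq) (splitAt-↑ʳ 3 3 j)) of λ ()

      π : Fin 6 → Fin 8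
      π x = [ (λ i → flip i w) , const w ]′ (splitAt 3 x)

      π-left : ∀ i → π (left i) ≡ flip i w
      π-left i = cong [ (λ i → flip i w) , const w ]′ (splitAt-↑ˡ 3 i 3)

      π-right : ∀ j → π (right j) ≡ w
      π-right j = cong [ (λ i → flip i w) , const w ]′ (splitAt-↑ʳ 3 3 j)

      at-w : ∀ {i c} → c ≡ b i → at (edge w i , c) ≡ w
      at-w {i} refl = proj₂ (half-at w i)

      -- The edges at `flip i w` share a colour and therefore a direction. As `b i` marks the half
      -- of `edge w i` at `w`, the halves at `flip i w` all bear the other mark.
      at-w⁻ : ∀ {i c} → at (edge w i , c) ≡ w → c ≡ b i
      at-flip⁻ : ∀ {i j c} → at (edge (flip i w) j , c) ≡ flip i w → c ≢ b i
      at-flip : ∀ {i j c} → c ≢ b i → at (edge (flip i w) j , c) ≡ flip i w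

      at-flip⁻ {i} {j} at≡ refl = not-¬ refl
        (trans (cong parity (sym (at-w {i} refl)))
          (trans (parity-at {edge w i} {edge (flip i w) j} (b i) (sym (proj₂ (sameColour⇒≋ {edge (flip i w) j} {edge w i} (mono i j)))))
            (trans (cong parity at≡) (parity-flip i w))))

      at-flip {i} {j} {c} c≢b with b′ , at≡ ← half-at (flip i w) j =
        subst (λ c → at (edge (flip i w) j , c) ≡ flip i w)
          (trans (¬-not (at-flip⁻ {i} {j} {b′} at≡)) (sym (¬-not c≢b))) at≡

      at-w⁻ {i} {c} at≡ with c ≟ᵇ b i
      ... | yes c≡b = c≡b
      ... | no  c≢b = contradiction (trans (cong parity (trans (sym at≡) (trans (cong (λ e → at (e , c)) (sym (edge-flip i w))) (at-flip {i} {i} c≢b)))) (parity-flip i w)) (not-¬ refl)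

      -- The half on the right goes to `w` and the half on the left to `flip i w`, possibly on
      -- different edges of the cube; by `mono` these have the same colour.
      φ : H.Half → Half
      φ (e , c) with c ≟ᵇ b (row e)
      ... | yes _ = edge w (row e) , c
      ... | no  _ = edge (flip (row e) w) (column e) , c

      φ-right : ∀ {e c} → c ≡ b (row e) → φ (e , c) ≡ (edge w (row e) , c)
      φ-right {e} {c} c≡b with c ≟ᵇ b (row e)
      ... | yes _   = refl
      ... | no  c≢b = contradiction c≡b c≢b

      φ-left : ∀ {e c} → c ≢ b (row e) → φ (e , c) ≡ (edge (flip (row e) w) (column e) , c)
      φ-left {e} {c} c≢b with c ≟ᵇ b (row e)
      ... | yes c≡b = contradiction c≡b c≢b
      ... | no  _   = refl

      φ-bool : ∀ h → proj₂ (φ h) ≡ proj₂ h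
      φ-bool (e , c) with c ≟ᵇ b (row e)
      ... | yes _ = refl
      ... | no  _ = refl

      label-φ : ∀ h → label (φ h) ≡ H.label h
      label-φ (e , c) with c ≟ᵇ b (row e)
      label-φ (e , true)  | yes _ = refl
      label-φ (e , false) | yes _ = refl
      label-φ (e , true)  | no  _ = cong colour (mono (row e) (column e))
      label-φ (e , false) | no  _ = cong (λ i → ℤ.- colour i) (mono (row e) (column e))

      at-φ : ∀ h → at (φ h) ≡ π (H.at h)
      at-φ (e , c) with c ≟ᵇ b (row e)
      ... | yes c≡b = trans (at-w {row e} c≡b) (sym (trans (cong π (at-right e c c≡b)) (π-right (column e))))
      ... | no  c≢b = trans (at-flip {row e} {column e} c≢b) (sym (trans (cong π (at-left e c c≢b)) (π-left (row e))))

      -- For a half on the right, `φ` forgets the column, which its vertex still determines; on the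
      -- left the vertex gives the row and `φ` the column.
      φ-injective : ∀ h h′ → H.at h ≡ H.at h′ → φ h ≡ φ h′ → h ≡ h′
      φ-injective (e , c) (e′ , c′) at≡ φ≡
        with refl ← trans (sym (φ-bool (e , c))) (trans (cong proj₂ φ≡) (φ-bool (e′ , c′)))
        with c ≟ᵇ b (row e) | c ≟ᵇ b (row e′)
      ... | yes p | yes q = cong (_, c) (row-column-injective {e} {e′} (edge-injective w (row e) (row e′) (cong proj₁ φ≡))
                              (↑ʳ-injective 3 (column e) (column e′) (trans (sym (at-right e c p)) (trans at≡ (at-right e′ c q)))))
      ... | yes p | no  q = contradiction (trans (sym (at-left e′ c q)) (trans (sym at≡) (at-right e c p))) (left≢right (row e′) (column e))
      ... | no  p | yes q = contradiction (trans (sym (at-left e c p)) (trans at≡ (at-right e′ c q))) (left≢right (row e) (column e′))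
      ... | no  p | no  q = cong (_, c) (row-column-injective {e} {e′} row≡ (edge-injective (flip (row e) w) (column e) (column e′)
                              (trans (cong proj₁ φ≡) (cong (λ i → edge (flip i w) (column e′)) (sym row≡)))))
        where
        row≡ : row e ≡ row e′
        row≡ = ↑ˡ-injective 3 (row e) (row e′) (trans (sym (at-left e c p)) (trans at≡ (at-left e′ c q)))

      φ-surjective : ∀ x g → at g ≡ π x → ∃[ h ] H.at h ≡ x × φ h ≡ g
      φ-surjective x (f , c) at≡ with splitAt 3 x in eq
      ... | inj₁ i with j , refl ← at-edge (f , c) at≡ = (combine i j , c) ,
            trans (at-left _ c c≢b) (trans (cong left (row-combine i j)) (splitAt⁻¹-↑ˡ eq)) ,
            trans (φ-left c≢b) (cong₂ (λ i j → edge (flip i w) j , c) (row-combine i j) (column-combine i j))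
        where
        c≢b : c ≢ b (row (combine i j))
        c≢b = subst (λ i → c ≢ b i) (sym (row-combine i j)) (at-flip⁻ {i} {j} at≡)
      ... | inj₂ j with i , refl ← at-edge (f , c) at≡ = (combine i j , c) ,
            trans (at-right _ c c≡b) (trans (cong right (column-combine i j)) (splitAt⁻¹-↑ʳ eq)) ,
            trans (φ-right c≡b) (cong (λ i → edge w i , c) (row-combine i j))
        where
        c≡b : c ≡ b (row (combine i j))
        c≡b = subst (λ i → c ≡ b i) (sym (row-combine i j)) (at-w⁻ {i} at≡)

    not-three-stars : ⊥
    not-three-stars = unique (graph₃₃ , realizes P orientation₃₃ col₃₃ tiles′ , graph₃₃≄Q , from-yes (6 ℕₚ.≤? 8))
      where
      tiles′ : ∀ x → tile D₃₃ col₃₃ x ∈ₚ P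
      tiles′ x = ∈ₚ-resp-↭ P (↭-sym (local-isomorphism π φ label-φ at-φ φ-injective φ-surjective x)) (sub (π x))

  colourIndex : Fin 12 → Fin ∣Σ P ∣
  colourIndex e = index (colour∈colours {P} sub e)

  colourIndex-injective : ∀ {e f} → colourIndex e ≡ colourIndex f → col e ≡ col f
  colourIndex-injective {e} {f} eq = colour-injective
    (Membershipₛ.index-injective (setoid ℤ.ℤ) (colour∈colours {P} sub e) (colour∈colours {P} sub f) eq)

  five≤∣Σ∣ : 5 ≤ ∣Σ P ∣
  five≤∣Σ∣ = ℕₚ.≰⇒> λ k≤4 →
    let a : Fin 12 → Fin 4
        a e = inject≤ (colourIndex e) k≤4
        a⇒col : ∀ e f → a e ≡ a f → col e ≡ col f
        a⇒col e f eq = colourIndex-injective {e} {f} (inject≤-injective k≤4 k≤4 _ _ eq)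
    in case stars a (λ e f eq → proj₁ (sameColour⇒≋ {e} {f} (a⇒col e f eq))) of λ where
      -- The centre `w` must lie on the side without the monochromatic stars: `7F` is odd with even
      -- neighbours, and `0F` is even with odd ones.
      (inj₁ even-stars) → not-three-stars 7F λ i j →
        let e = edge (flip i 7F) j; f = edge 7F i in a⇒col e f (even-stars e f (even-edge-7F i j))
      (inj₂ odd-stars)  → not-three-stars 0F λ i j →
        let e = edge (flip i 0F) j; f = edge 0F i in a⇒col e f (odd-stars e f (odd-edge-0F i j))

-- The graphs realized by P₂

orientation-P₂ : Orientation Q
orientation-P₂ = record { arc = λ e → even e , odd e ; orients = λ e → ≈ᵤ-sym (ends-Q e) }

-- Here `0F` is colour 1. The even vertices `0F`, `3F`, `5F`, `6F` receive {1,1,1}, {3,4,5},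
-- {3,4,5}, {2,2,2}, and the odd ones the tiles with negative entries.
colouring-P₂ : EdgeColouring (Orientation.digraph orientation-P₂) 5
colouring-P₂ = lookup (0F ∷ 0F ∷ 0F ∷ 3F ∷ 3F ∷ 4F ∷ 1F ∷ 2F ∷ 4F ∷ 1F ∷ 2F ∷ 1F ∷ [])

P₂-realizes-Q : P₂ Realizes Q
P₂-realizes-Q = realizes P₂ orientation-P₂ colouring-P₂ λ
  { 0F → here Perm.refl
  ; 1F → there (there (there (here Perm.refl)))
  ; 2F → there (there (there (there (there (here (prep _ (Perm.swap _ _ Perm.refl)))))))
  ; 3F → there (there (there (there (here rotate))))
  ; 4F → there (there (there (there (there (here (prep _ (Perm.swap _ _ Perm.refl)))))))
  ; 5F → there (there (there (there (here rotate))))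
  ; 6F → there (here Perm.refl)
  ; 7F → there (there (here rotate))
  }
  where
  rotate : ∀ {a b c : ℤ} → (b ∷ c ∷ a ∷ []) ↭ (a ∷ b ∷ c ∷ [])
  rotate = ↭-trans (prep _ (Perm.swap _ _ Perm.refl)) (Perm.swap _ _ Perm.refl)

-- Places in the tiles and the halves that fill them

tileEntry : Fin 6 → Fin 3 → ℤ
tileEntry i p = lookup (lookup tileVecs i) p
  where
  tileVecs : Vec (Vec ℤ 3) 6
  tileVecs =
    (+ 1 ∷ + 1 ∷ + 1 ∷ []) ∷
    (+ 2 ∷ + 2 ∷ + 2 ∷ []) ∷
    (- + 2 ∷ - + 3 ∷ - + 3 ∷ []) ∷
    (- + 1 ∷ - + 4 ∷ - + 4 ∷ []) ∷
    (+ 3 ∷ + 4 ∷ + 5 ∷ []) ∷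
    (- + 1 ∷ - + 2 ∷ - + 5 ∷ []) ∷ []

entries : ∀ i → List.lookup P₂-tiles i ≡ tileEntry i 0F ∷ tileEntry i 1F ∷ tileEntry i 2F ∷ []
entries 0F = refl
entries 1F = refl
entries 2F = refl
entries 3F = refl
entries 4F = refl
entries 5F = refl

-- A half with such a label is determined by its vertex, see `solo-unique`.
Solo : ℤ → Set
Solo z = ∀ i p q → tileEntry i p ≡ z → tileEntry i q ≡ z → p ≡ q

solo? : ∀ z → Dec (Solo z)
solo? z = all? λ i → all? λ p → all? λ q → (tileEntry i p ℤₚ.≟ z) →-dec (tileEntry i q ℤₚ.≟ z) →-dec (p ≟ᶠ q)

module Slots (D : Digraph) {c : ℕ} (col : EdgeColouring D c) (sub : ∀ x → tile D col x ∈ₚ P₂) where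
  open HalfEdges D col
  open Digraph D using (order)

  kind : Fin order → Fin 6
  kind x = index (sub x)

  -- A matching of the three places of the tile with the halves at `x`; among equal entries it is a
  -- choice.
  record Slots (x : Fin order) : Set where
    field
      slot            : Fin 3 → Half
      label-slot      : ∀ p → label (slot p) ≡ tileEntry (kind x) p
      at-slot         : ∀ p → at (slot p) ≡ x
      slot-injective  : ∀ {p q} → slot p ≡ slot q → p ≡ q
      slot-surjective : ∀ h → at h ≡ x → ∃[ p ] slot p ≡ h

  abstract
    slots : ∀ x → Slots x
    slots x = fromHalves hs labels star↭hs
      where
      permuted : ∃[ hs ] tileEntry (kind x) 0F ∷ tileEntry (kind x) 1F ∷ tileEntry (kind x) 2F ∷ [] ≡ map label hs × star x ↭ hs
      permuted = ↭-map-inv label (↭-trans (↭-reflexive (map-label-star x))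
        (↭-trans (Anyₚ.lookup-index (sub x)) (↭-reflexive (entries (kind x)))))
      hs : List Half
      hs = proj₁ permuted
      labels : tileEntry (kind x) 0F ∷ tileEntry (kind x) 1F ∷ tileEntry (kind x) 2F ∷ [] ≡ map label hs
      labels = proj₁ (proj₂ permuted)
      star↭hs : star x ↭ hs
      star↭hs = proj₂ (proj₂ permuted)
      fromHalves : ∀ hs → tileEntry (kind x) 0F ∷ tileEntry (kind x) 1F ∷ tileEntry (kind x) 2F ∷ [] ≡ map label hs →
                   star x ↭ hs → Slots x
      fromHalves (h₀ ∷ h₁ ∷ h₂ ∷ []) eq star↭hs = record
        { slot            = List.lookup (h₀ ∷ h₁ ∷ h₂ ∷ [])
        ; label-slot      = λ { 0F → sym (∷-injectiveˡ eq)
                              ; 1F → sym (∷-injectiveˡ (∷-injectiveʳ eq))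
                              ; 2F → sym (∷-injectiveˡ (∷-injectiveʳ (∷-injectiveʳ eq))) }
        ; at-slot         = λ p → ∈-star⁻ (∈-resp-↭ (↭-sym star↭hs) (∈-lookup p))
        ; slot-injective  = lookup-injective (Permutationₛ.Unique-resp-↭ (setoid Half) (↭⇒↭ₛ star↭hs) (star-unique x))
        ; slot-surjective = λ h at≡x → let h∈hs = ∈-resp-↭ star↭hs (subst (λ y → h ∈ star y) at≡x (∈-star⁺ h))
                                       in index h∈hs , sym (Anyₚ.lookup-index h∈hs)
        }

  module _ (x : Fin order) where
    open Slots (slots x) public

  entry : ∀ h → ∃[ p ] tileEntry (kind (at h)) p ≡ label h
  entry h with p , eq ← slot-surjective (at h) h refl = p , trans (sym (label-slot (at h) p)) (cong label eq)

  solo-unique : ∀ {z h h′} → Solo z → label h ≡ z → label h′ ≡ z → at h ≡ at h′ → h ≡ h′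
  solo-unique {z} {h} {h′} solo lab lab′ at≡
    with p , eq ← slot-surjective (at h) h refl | p′ , eq′ ← slot-surjective (at h) h′ (sym at≡)
    = trans (sym eq) (trans (cong (slot (at h)) (solo (kind (at h)) p p′ (entry≡ eq lab) (entry≡ eq′ lab′))) eq′)
    where
    entry≡ : ∀ {p h″} → slot (at h) p ≡ h″ → label h″ ≡ z → tileEntry (kind (at h)) p ≡ z
    entry≡ {p} eq lab = trans (sym (label-slot (at h) p)) (trans (cong label eq) lab)

-- A missed value could be added in front, giving an injection from `Fin (suc m)` to `Fin n`.
injective∧≤⇒surjective : ∀ {m n} {f : Fin m → Fin n} → n ≤ m → (∀ {i j} → f i ≡ f j → i ≡ j) → ∀ y → ∃[ i ] f i ≡ y
injective∧≤⇒surjective {m} {n} {f} n≤m inj y with any? (λ i → f i ≟ᶠ y)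
... | yes hit  = hit
... | no  miss = contradiction (injective⇒≤ {f = g} (λ {i} {j} → g-injective i j)) (ℕₚ.<⇒≱ (s≤s n≤m))
  where
  g : Fin (suc m) → Fin n
  g Fin.zero    = y
  g (Fin.suc i) = f i
  g-injective : ∀ i j → g i ≡ g j → i ≡ j
  g-injective Fin.zero    Fin.zero    eq = refl
  g-injective Fin.zero    (Fin.suc j) eq = contradiction (j , sym eq) miss
  g-injective (Fin.suc i) Fin.zero    eq = contradiction (i , eq) miss
  g-injective (Fin.suc i) (Fin.suc j) eq = cong Fin.suc (inj eq)

-- The P₂-coloured cube: the tile at a vertex, and for every edge an end at
-- which its label occurs only once, the place of this label in the tile, and the other end.
vertexKind : Fin 8 → Fin 6
vertexKind = lookup (0F ∷ 3F ∷ 5F ∷ 4F ∷ 5F ∷ 4F ∷ 1F ∷ 2F ∷ [])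

soloEnd otherEnd : Fin 12 → Fin 8
soloEnd  = lookup (1F ∷ 2F ∷ 4F ∷ 3F ∷ 5F ∷ 3F ∷ 2F ∷ 3F ∷ 5F ∷ 4F ∷ 5F ∷ 7F ∷ [])
otherEnd = lookup (0F ∷ 0F ∷ 0F ∷ 1F ∷ 1F ∷ 2F ∷ 6F ∷ 7F ∷ 4F ∷ 6F ∷ 7F ∷ 6F ∷ [])

soloPlace : Fin 12 → Fin 3
soloPlace = lookup (0F ∷ 0F ∷ 0F ∷ 1F ∷ 1F ∷ 2F ∷ 1F ∷ 0F ∷ 2F ∷ 1F ∷ 0F ∷ 0F ∷ [])

soloLabel : Fin 12 → ℤ
soloLabel q = tileEntry (vertexKind (soloEnd q)) (soloPlace q)

abstract
  ends-solo : ∀ q → (soloEnd q , otherEnd q) ≈ᵤ (even q , odd q)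
  ends-solo = from-yes (all? λ q → (soloEnd q , otherEnd q) ≈ᵤ? (even q , odd q))

  soloLabel-solo : ∀ q → Solo (soloLabel q)
  soloLabel-solo = from-yes (all? λ q → solo? (soloLabel q))

  -5-solo : Solo (- + 5)
  -5-solo = from-yes (solo? (- + 5))

  solo-injective : ∀ q r → soloEnd q ≡ soloEnd r → soloLabel q ≡ soloLabel r → q ≡ r
  solo-injective = from-yes (all? λ q → all? λ r → (soloEnd q ≟ᶠ soloEnd r) →-dec (soloLabel q ℤₚ.≟ soloLabel r) →-dec (q ≟ᶠ r))

  -- The solo labels are -1, -2, 3, 4 and 5, one sign for each colour. Hence the two halves of an
  -- edge of `H` never represent two edges of the cube.
  solo-not-opposite : ∀ q r → soloLabel r ≢ - soloLabel q
  solo-not-opposite = from-yes (all? λ q → all? λ r → ¬? (soloLabel r ℤₚ.≟ - soloLabel q))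

  solo-exists : ∀ i p j r → tileEntry (vertexKind j) r ≡ - tileEntry (vertexKind i) p →
                ∃[ q ] (soloEnd q ≡ i × soloLabel q ≡ tileEntry (vertexKind i) p
                      ⊎ soloEnd q ≡ j × soloLabel q ≡ tileEntry (vertexKind j) r)
  solo-exists = from-yes (all? λ i → all? λ p → all? λ j → all? λ r →
    (tileEntry (vertexKind j) r ℤₚ.≟ - tileEntry (vertexKind i) p) →-dec
    any? λ q → ((soloEnd q ≟ᶠ i) ×-dec (soloLabel q ℤₚ.≟ tileEntry (vertexKind i) p))
         ⊎-dec ((soloEnd q ≟ᶠ j) ×-dec (soloLabel q ℤₚ.≟ tileEntry (vertexKind j) r)))

  -- For the colours 1 to 4, the opposite label occurs in one kind of tile, borne by one vertex of
  -- the cube. The edges `5F` and `8F` have colour 5, and the tile with -5 is borne by both `2F` and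
  -- `4F`.
  other-kind : ∀ q i p j → q ≢ 5F → q ≢ 8F → tileEntry i p ≡ - soloLabel q → i ≡ vertexKind j → j ≡ otherEnd q
  other-kind = from-yes (all? λ q → all? λ i → all? λ p → all? λ j → ¬? (q ≟ᶠ 5F) →-dec ¬? (q ≟ᶠ 8F) →-dec
    (tileEntry i p ℤₚ.≟ - soloLabel q) →-dec (i ≟ᶠ vertexKind j) →-dec (j ≟ᶠ otherEnd q))

  -- Following the last entry of a tile leads to {3,4,5} in at most two steps.
  two-steps : ∀ i j q → tileEntry j q ≡ - tileEntry i 2F →
              i ≡ 4F ⊎ j ≡ 4F ⊎ (∀ k r → tileEntry k r ≡ - tileEntry j 2F → k ≡ 4F)
  two-steps = from-yes (all? λ i → all? λ j → all? λ q → (tileEntry j q ℤₚ.≟ - tileEntry i 2F) →-dec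
    ((i ≟ᶠ 4F) ⊎-dec (j ≟ᶠ 4F) ⊎-dec all? λ k → all? λ r → (tileEntry k r ℤₚ.≟ - tileEntry j 2F) →-dec (k ≟ᶠ 4F)))

  3-solo : Solo (+ 3)
  3-solo = from-yes (solo? (+ 3))

  1-kind : ∀ i p → tileEntry i p ≡ + 1 → i ≡ 0F
  1-kind = from-yes (all? λ i → all? λ p → (tileEntry i p ℤₚ.≟ + 1) →-dec (i ≟ᶠ 0F))

  2-kind : ∀ i p → tileEntry i p ≡ + 2 → i ≡ 1F
  2-kind = from-yes (all? λ i → all? λ p → (tileEntry i p ℤₚ.≟ + 2) →-dec (i ≟ᶠ 1F))

  -3-kind : ∀ i p → tileEntry i p ≡ - + 3 → i ≡ 2F
  -3-kind = from-yes (all? λ i → all? λ p → (tileEntry i p ℤₚ.≟ - + 3) →-dec (i ≟ᶠ 2F))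

  -4-kind : ∀ i p → tileEntry i p ≡ - + 4 → i ≡ 3F
  -4-kind = from-yes (all? λ i → all? λ p → (tileEntry i p ℤₚ.≟ - + 4) →-dec (i ≟ᶠ 3F))

  3-kind : ∀ i p → tileEntry i p ≡ + 3 → i ≡ 4F
  3-kind = from-yes (all? λ i → all? λ p → (tileEntry i p ℤₚ.≟ + 3) →-dec (i ≟ᶠ 4F))

  -5-kind : ∀ i p → tileEntry i p ≡ - + 5 → i ≡ 5F
  -5-kind = from-yes (all? λ i → all? λ p → (tileEntry i p ℤₚ.≟ - + 5) →-dec (i ≟ᶠ 5F))

  vertexKind-injective : ∀ i j → vertexKind i ≡ vertexKind j →
    i ≡ j ⊎ (i ≡ 2F × j ≡ 4F) ⊎ (i ≡ 4F × j ≡ 2F) ⊎ (i ≡ 3F × j ≡ 5F) ⊎ (i ≡ 5F × j ≡ 3F)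
  vertexKind-injective = from-yes (all? λ i → all? λ j → (vertexKind i ≟ᶠ vertexKind j) →-dec
    ((i ≟ᶠ j) ⊎-dec ((i ≟ᶠ 2F) ×-dec (j ≟ᶠ 4F)) ⊎-dec ((i ≟ᶠ 4F) ×-dec (j ≟ᶠ 2F))
              ⊎-dec ((i ≟ᶠ 3F) ×-dec (j ≟ᶠ 5F)) ⊎-dec ((i ≟ᶠ 5F) ×-dec (j ≟ᶠ 3F))))

-- Recovering the cube from the tiles

module Uniqueness (H : Graph) (order≤8 : Graph.order H ≤ 8) (O : Orientation H) {c : ℕ}
                  (col : EdgeColouring (Orientation.digraph O) c)
                  (sub : ∀ x → tile (Orientation.digraph O) col x ∈ₚ P₂) where
  open Orientation O using (orients)
  D : Digraph
  D = Orientation.digraph O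
  open Digraph D using (order; size)
  open HalfEdges D col
  open Slots D col sub using (kind; slot; label-slot; at-slot; slot-injective; entry; solo-unique)

  mate-injective : ∀ {h h′} → mate h ≡ mate h′ → h ≡ h′
  mate-injective {e , b} {e′ , b′} eq = cong₂ _,_ (cong proj₁ eq) (not-injective (cong proj₂ eq))

  label-mate′ : ∀ {z} h → label h ≡ z → label (mate h) ≡ - z
  label-mate′ h eq = trans (label-mate h) (cong -_ eq)

  Half[_at_] : ℤ → Fin order → Set
  Half[ z at x ] = ∃[ h ] at h ≡ x × label h ≡ z

  half : ∀ {x i} → kind x ≡ i → ∀ p → Half[ tileEntry i p at x ]
  half {x} refl p = slot x p , at-slot x p , label-slot x p

  entry′ : ∀ {h z} → label h ≡ z → ∃[ p ] tileEntry (kind (at h)) p ≡ z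
  entry′ {h} eq = Product.map₂ (λ e → trans e eq) (entry h)

  neighbour : ∀ x → Fin order
  neighbour x = at (mate (slot x 2F))

  neighbour-entry : ∀ x → ∃[ p ] tileEntry (kind (neighbour x)) p ≡ - tileEntry (kind x) 2F
  neighbour-entry x = entry′ {mate (slot x 2F)} (label-mate′ (slot x 2F) (label-slot x 2F))

  some-345 : Fin order → ∃[ x ] kind x ≡ 4F
  some-345 x with two-steps _ _ _ (proj₂ (neighbour-entry x))
  ... | inj₁ k≡4        = x , k≡4
  ... | inj₂ (inj₁ k≡4) = neighbour x , k≡4
  ... | inj₂ (inj₂ f)   = neighbour (neighbour x) , f _ _ (proj₂ (neighbour-entry (neighbour x)))

  -- A numbering of eight vertices of H as in the cube.  The edges of colour 5 are
  -- recorded because the tiles alone do not tell their ends apart.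
  record Frame : Set where
    field
      v           : Fin 8 → Fin order
      kind-v      : ∀ i → kind (v i) ≡ vertexKind i
      v-injective : ∀ {i j} → v i ≡ v j → i ≡ j
      five₁       : ∃[ h ] at h ≡ v 3F × label h ≡ + 5 × at (mate h) ≡ v 2F
      five₂       : ∃[ h ] at h ≡ v 5F × label h ≡ + 5 × at (mate h) ≡ v 4F

  kind≡ : ∀ {i z} → (∀ j p → tileEntry j p ≡ z → j ≡ i) → ∀ h → label h ≡ z → kind (at h) ≡ i
  kind≡ determined h eq with p , eq′ ← entry h = determined _ p (trans eq′ eq)

  frame : ∀ x → kind x ≡ 4F → Frame
  frame x kx = record
    { v           = v
    ; kind-v      = kind-v
    ; v-injective = λ {i} {j} eq → v-injective eq (vertexKind-injective i j (trans (sym (kind-v i)) (trans (cong kind eq) (kind-v j))))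
    ; five₁       = proj₁ f₁ , proj₁ (proj₂ f₁) , proj₂ (proj₂ f₁) , refl
    ; five₂       = proj₁ f₂ , proj₁ (proj₂ f₂) , proj₂ (proj₂ f₂) , refl
    }
    where
    h₃ : Half[ + 3 at x ]
    h₃ = half kx 0F
    C : Fin order
    C = at (mate (proj₁ h₃))
    kC : kind C ≡ 2F
    kC = kind≡ -3-kind (mate (proj₁ h₃)) (label-mate′ (proj₁ h₃) (proj₂ (proj₂ h₃)))
    g₁ g₂ : Half
    g₁ = slot C 1F
    g₂ = slot C 2F
    lg₁ : label g₁ ≡ - + 3
    lg₁ = trans (label-slot C 1F) (cong (λ i → tileEntry i 1F) kC)
    lg₂ : label g₂ ≡ - + 3
    lg₂ = trans (label-slot C 2F) (cong (λ i → tileEntry i 2F) kC)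
    E₁ E₂ : Fin order
    E₁ = at (mate g₁)
    E₂ = at (mate g₂)
    -- The entry 3 occurs once in {3,4,5}, so a common vertex would identify the two halves labelled
    -- -3 at `C`.
    E₁≢E₂ : E₁ ≢ E₂
    E₁≢E₂ eq = case slot-injective C (mate-injective {g₁} {g₂} (solo-unique {h = mate g₁} {mate g₂} 3-solo (label-mate′ g₁ lg₁) (label-mate′ g₂ lg₂) eq)) of λ ()
    kE₁ : kind E₁ ≡ 4F
    kE₁ = kind≡ 3-kind (mate g₁) (label-mate′ g₁ lg₁)
    kE₂ : kind E₂ ≡ 4F
    kE₂ = kind≡ 3-kind (mate g₂) (label-mate′ g₂ lg₂)
    f₁ : Half[ + 5 at E₁ ]
    f₁ = half kE₁ 2F
    f₂ : Half[ + 5 at E₂ ]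
    f₂ = half kE₂ 2F
    F₁ F₂ : Fin order
    F₁ = at (mate (proj₁ f₁))
    F₂ = at (mate (proj₁ f₂))
    lf₁ : label (mate (proj₁ f₁)) ≡ - + 5
    lf₁ = label-mate′ (proj₁ f₁) (proj₂ (proj₂ f₁))
    lf₂ : label (mate (proj₁ f₂)) ≡ - + 5
    lf₂ = label-mate′ (proj₁ f₂) (proj₂ (proj₂ f₂))
    F₁≢F₂ : F₁ ≢ F₂
    F₁≢F₂ eq = E₁≢E₂ (trans (sym (proj₁ (proj₂ f₁)))
      (trans (cong at (mate-injective {proj₁ f₁} {proj₁ f₂} (solo-unique {h = mate (proj₁ f₁)} {mate (proj₁ f₂)} -5-solo lf₁ lf₂ eq))) (proj₁ (proj₂ f₂))))
    kF₁ : kind F₁ ≡ 5F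
    kF₁ = kind≡ -5-kind (mate (proj₁ f₁)) lf₁
    kF₂ : kind F₂ ≡ 5F
    kF₂ = kind≡ -5-kind (mate (proj₁ f₂)) lf₂
    d : Half[ + 4 at E₁ ]
    d = half kE₁ 1F
    a : Half[ - + 1 at F₁ ]
    a = half kF₁ 0F
    b : Half[ - + 2 at F₁ ]
    b = half kF₁ 1F
    -- These are reached from `F₁` and `E₁` alone. That `F₂` and `E₂` lead to the same vertices is
    -- derived in `at-mate` from the bound on the order.
    A B D′ : Fin order
    A  = at (mate (proj₁ a))
    B  = at (mate (proj₁ b))
    D′ = at (mate (proj₁ d))
    v : Fin 8 → Fin order
    v = lookup (A ∷ D′ ∷ F₁ ∷ E₁ ∷ F₂ ∷ E₂ ∷ B ∷ C ∷ [])
    kind-v : ∀ i → kind (v i) ≡ vertexKind i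
    kind-v 0F = kind≡ 1-kind (mate (proj₁ a)) (label-mate′ (proj₁ a) (proj₂ (proj₂ a)))
    kind-v 1F = kind≡ -4-kind (mate (proj₁ d)) (label-mate′ (proj₁ d) (proj₂ (proj₂ d)))
    kind-v 2F = kF₁
    kind-v 3F = kE₁
    kind-v 4F = kF₂
    kind-v 5F = kE₂
    kind-v 6F = kind≡ 2-kind (mate (proj₁ b)) (label-mate′ (proj₁ b) (proj₂ (proj₂ b)))
    kind-v 7F = kC
    v-injective : ∀ {i j} → v i ≡ v j →
      i ≡ j ⊎ (i ≡ 2F × j ≡ 4F) ⊎ (i ≡ 4F × j ≡ 2F) ⊎ (i ≡ 3F × j ≡ 5F) ⊎ (i ≡ 5F × j ≡ 3F) → i ≡ j
    v-injective eq (inj₁ i≡j) = i≡j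
    v-injective eq (inj₂ (inj₁ (refl , refl))) = contradiction eq F₁≢F₂
    v-injective eq (inj₂ (inj₂ (inj₁ (refl , refl)))) = contradiction (sym eq) F₁≢F₂
    v-injective eq (inj₂ (inj₂ (inj₂ (inj₁ (refl , refl))))) = contradiction eq E₁≢E₂
    v-injective eq (inj₂ (inj₂ (inj₂ (inj₂ (refl , refl))))) = contradiction (sym eq) E₁≢E₂

  same-edge : ∀ {h h′} → proj₁ h ≡ proj₁ h′ → h′ ≡ h ⊎ h′ ≡ mate h
  same-edge {e , true}  {e , true}  refl = inj₁ refl
  same-edge {e , true}  {e , false} refl = inj₂ refl
  same-edge {e , false} {e , true}  refl = inj₂ refl
  same-edge {e , false} {e , false} refl = inj₁ refl

  ends-mate : ∀ h → (at h , at (mate h)) ≈ᵤ Graph.ends H (proj₁ h)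
  ends-mate (e , true)  = orients e
  ends-mate (e , false) = ≈ᵤ-trans (inj₂ refl) (orients e)

  module _ (F : Frame) where
    open Frame F

    v-surjective : ∀ y → ∃[ i ] v i ≡ y
    v-surjective = injective∧≤⇒surjective order≤8 v-injective

    soloHalf : ∀ q → Half[ soloLabel q at v (soloEnd q) ]
    soloHalf q = half (kind-v (soloEnd q)) (soloPlace q)

    w : Fin 12 → Fin size
    w q = proj₁ (proj₁ (soloHalf q))

    soloHalf-unique : ∀ q h → at h ≡ v (soloEnd q) → label h ≡ soloLabel q → h ≡ proj₁ (soloHalf q)
    soloHalf-unique q h at≡ lab = let g , at-g , lg = soloHalf q in
      solo-unique (soloLabel-solo q) lab lg (trans at≡ (sym at-g))

    -- The frame records this for colour 5. For the other colours the far end is some `v j`, as `v`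
    -- is surjective, and its kind determines `j`.
    at-mate : ∀ q → at (mate (proj₁ (soloHalf q))) ≡ v (otherEnd q)
    at-mate q with q ≟ᶠ 5F | q ≟ᶠ 8F
    ... | yes refl | _ = let h , at≡ , lab , other = five₁ in trans (cong (at ∘ mate) (sym (soloHalf-unique 5F h at≡ lab))) other
    ... | no _ | yes refl = let h , at≡ , lab , other = five₂ in trans (cong (at ∘ mate) (sym (soloHalf-unique 8F h at≡ lab))) other
    ... | no q≢5 | no q≢8 =
      let h , _ , lab = soloHalf q
          j , vj≡ = v-surjective (at (mate h))
          p , eq = entry (mate h)
      in trans (sym vj≡) (cong v (other-kind q (kind (at (mate h))) p j q≢5 q≢8 (trans eq (label-mate′ h lab))
           (trans (cong kind (sym vj≡)) (kind-v j))))

    w-injective : ∀ {q r} → w q ≡ w r → q ≡ r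
    w-injective {q} {r} eq =
      let h , at-h , lh = soloHalf q
          g , at-g , lg = soloHalf r
      in case same-edge {h} {g} eq of λ where
        (inj₁ g≡h) → solo-injective q r
          (v-injective (trans (sym at-h) (trans (cong at (sym g≡h)) at-g)))
          (trans (sym lh) (trans (cong label (sym g≡h)) lg))
        (inj₂ g≡mate) → contradiction
          (trans (sym lg) (trans (cong label g≡mate) (label-mate′ h lh))) (solo-not-opposite q r)

    -- One of the two halves of an edge bears a solo label, and no other half at its vertex bears
    -- the same label.
    w-surjective : ∀ e → ∃[ q ] w q ≡ e
    w-surjective e =
      let i , vi≡ = v-surjective (at (e , true))
          j , vj≡ = v-surjective (at (e , false))
          p , eqp = entry (e , true)
          r , eqr = entry (e , false)
          kp = trans (cong (λ k → tileEntry k p) (trans (sym (kind-v i)) (cong kind vi≡))) eqp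
          kr = trans (cong (λ k → tileEntry k r) (trans (sym (kind-v j)) (cong kind vj≡))) eqr
      in case solo-exists i p j r (trans kr (cong -_ (sym kp))) of λ where
        (q , inj₁ (end≡ , lab≡)) → q , cong proj₁ (sym (soloHalf-unique q (e , true)
          (trans (sym vi≡) (cong v (sym end≡))) (trans (sym kp) (sym lab≡))))
        (q , inj₂ (end≡ , lab≡)) → q , cong proj₁ (sym (soloHalf-unique q (e , false)
          (trans (sym vj≡) (cong v (sym end≡))) (trans (sym kr) (sym lab≡))))

    Q≃H : Q ≃ H
    Q≃H = record
      { vertices = mk⤖ (v-injective , strictlySurjective⇒surjective v-surjective)
      ; edges    = mk⤖ (w-injective , strictlySurjective⇒surjective w-surjective)
      ; ends     = λ q → let h , at≡ , _ = soloHalf q in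
          ≈ᵤ-trans (≈ᵤ-map v (≈ᵤ-trans (ends-Q q) (≈ᵤ-sym (ends-solo q))))
            (≈ᵤ-trans (inj₁ (cong₂ _,_ (sym at≡) (sym (at-mate q)))) (ends-mate h))
      }

-- Biminimality of the pot

someVertex : ∀ {n} → NonZero n → Fin n
someVertex {suc n} _ = Fin.zero

P₂-realizes-only-Q : ∀ H → P₂ Realizes H → Graph.order H ≤ 8 → H ≃ Q
P₂-realizes-only-Q H (O , c , col , sub) order≤8 = ≃-sym (Q≃H (frame x kx))
  where
  open Uniqueness H order≤8 O col (λ x → sub (x , ↭-refl))
  x,kx = some-345 (someVertex (Graph.nonEmpty H))
  x = proj₁ x,kx
  kx = proj₂ x,kx

P₂-3-realizes-Q : P₂ 3-Realizes Q
P₂-3-realizes-Q = P₂-realizes-Q , λ (H , realizes , H≄Q , order≤8) → H≄Q (P₂-realizes-only-Q H realizes order≤8)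

IsT₃-Q : IsT₃ Q ∣ P₂ ∣ₚ
IsT₃-Q = (P₂ , P₂-3-realizes-Q , refl) , λ { (P , ((O , c , col , sub) , unique) , refl) →
  Tiles.six≤∣P∣ P unique O col λ x → sub (x , ↭-refl) }

IsB₃-Q : IsB₃ Q ∣Σ P₂ ∣
IsB₃-Q = (P₂ , P₂-3-realizes-Q , refl) , λ { (P , ((O , c , col , sub) , unique) , refl) →
  Colours.five≤∣Σ∣ P unique O col λ x → sub (x , ↭-refl) }

proposition2 : Biminimal P₂ Q
proposition2 = P₂-3-realizes-Q , IsT₃-Q , IsB₃-Q
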